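{- Proof schemata based on point transition systems can prove inductive statements that are not provable in $\mathsf{LKID}$.
   Context: **$\mathsf{LKID}$.** The finitary sequent calculus of Brotherston and Simpson for classical first-order logic with equality and inductively defined predicates, with explicit induction rules. An inductive definition set is a finite set of productions "from $Q_1(\mathbf u_1),\ldots,Q_h(\mathbf u_h),P_{j_1}(\mathbf t_1),\ldots,P_{j_m}(\mathbf t_m)$ infer $P_i(\mathbf t)$" with $Q_1,\ldots,Q_h$ ordinary and $P_{j_1},\ldots,P_{j_m},P_i$ inductive predicate symbols; e.g. the predicate $N$ of natural numbers has the productions "$N0$" and "from $Nx$ infer $Ns(x)$". The rules are those of Gentzen's $\mathbf{LK}$ (with cut), substitution and equality rules, for each production a right-introduction rule (from $\Gamma\vdash\Delta,A$ for every instantiated premise $A$ of the production infer $\Gamma\vdash\Delta,B$ for its instantiated conclusion $B$), and for each inductive predicate an induction rule on the left. For $N$ the latter is: from $\Gamma\vdash F(0),\Delta$ and $\Gamma,F(z)\vdash F(s(z)),\Delta$ and $\Gamma,F(t)\vdash\Delta$ infer $\Gamma,Nt\vdash\Delta$, for any formula $F$ and a fresh variable $z$; for other inductive predicates it is the analogous rule generated by the productions. **Language of schemata.** Pairwise disjoint sets: parameters $\mathcal N$ (variables over the natural numbers), ordinary free variables $V_f$, bound variables $V_b$. $\mathcal N$-formulas and (multiset) $\mathcal N$-sequents are first-order formulas and sequents over these, with $0$, successor $s$, predecessor $p$, and further function and predicate symbols. $T_0$ is the set of terms built from parameters, $0,s,p$ only; with $p(0)=0$, $p(s(x))=x$, each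 parameter-free term of $T_0$ evaluates to a numeral. A parameter assignment $\sigma$ maps parameters to numerals and extends homomorphically. A parameter substitution maps finitely many parameters to terms of $T_0$. $\mathbf{LK}_{\mathcal N}$ is Gentzen's sequent calculus on $\mathcal N$-sequents (multiplicative binary rules, weakening, contraction, cut, usual logical rules), where eigenvariables of $\forall_r,\exists_l$ must belong to $V_f$. Axioms are atomic sequents: tautological ones, those valid in first-order logic with equality, and the $C$-axioms below. Conditions are Boolean combinations of $\top,\bot$, $s^\alpha(v)\,\triangle\,s^\beta(0)$ and $s^\alpha(v)\,\triangle\,s^\beta(w)$ ($v\neq w$ parameters, $\triangle\in\{=,<,>,\le,\ge\}$). A finite set of conditions is a partition if under every parameter assignment exactly one of them is true. **Proof schemata.** To each proof symbol $\rho$ are assigned a finite parameter set $\mathcal N(\rho)$ and an $\mathcal N$-sequent $\mathrm{Seq}(\rho)$ whose set of parameters is $\mathcal N(\rho)$. If $\mathcal N(\rho)=\{m_1,\ldots,m_l\}$ then $\rho(m_1,\ldots,m_l)\theta$ is a proof term for any parameter substitution $\theta$. An $s$-proof corresponding to $\rho$ is an $\mathbf{LK}_{\mathcal N}$-derivation of $\mathrm{Seq}(\rho)$, with set of parameters $\mathcal N(\rho)$, in which some initial sequents $S'$ are conclusions of a call inference with premise a proof term $\rho'(k_1,\ldots,k_r)\theta$, where $\mathrm{Seq}(\rho')\theta=S'$. A semi-proof schema is a tuple $(\rho_0,R,\mathcal N_0,t,\mathrm{Seq},\Pi)$ with $R$ a set of proof symbols, $\rho_0\in R$, $\mathcal N_0$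 a finite set of parameters, $t(\rho)$ the tuple of parameters of $\rho$ (all from $\mathcal N_0$), and $\Pi$ assigning to each $\rho\in R$ a definition $\rho(m_1,\ldots,m_l)=\{C_1:\xi_1(\rho),\ldots,C_k:\xi_k(\rho)\}$, where $\{C_1,\ldots,C_k\}$ is a partition and each $\xi_j(\rho)$ is an $s$-proof corresponding to $\rho$ whose leaves are axioms or proof terms for symbols in $R$. In $\xi_j(\rho)$ one may also use as axioms ($C_j$-axioms) sequents of atoms $u\circ v$ with $u,v\in T_0$, $\circ\in\{<,>,=,\le,\ge\}$, that are entailed by $C_j$ under the standard interpretation. **Point transition systems.** A point transition system consists of a start label, a set of labels, a set of end labels, and a finite set of conditional transitions $(\delta,q)\to\mathcal L:C$, where $\delta$ is a label, $q$ a tuple of distinct parameters (the same for all transitions of $\delta$), $\mathcal L$ a nonempty finite set of pairs (label, tuple of $T_0$-terms over the parameters in $q$), and the conditions $C$ (over the parameters in $q$) of the transitions of each label that has any form a partition; the start label has transitions, end labels have none. The point transition system associated with a semi-proof schema has start label $\rho_0$, labels $R\cup\{\delta_e\}$, a fresh end label $\delta_e$, and, for each $\rho\in R$ and $j$, the transition $(\rho,t(\rho))\to\mathcal L_j:C_j$, where $\mathcal L_j$ is the set of pairs $(\rho',(u_1,\ldots,u_r))$ for the proof terms $\rho'(u_1,\ldots,u_r)$ at leaves of $\xi_j(\rho)$ (or $\{(\delta_e,t(\rho))\}$ if there are none). Write $\rho\to^*\rho'$ for the transitive closure of "$\rho'$ occurs in some $\mathcal L_j$ of $\rho$". The semi-proof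 schema is a *proof schema* (based on a point transition system) if this system is canonic: there is a well-founded strict ordering $<_l$ on tuples of numerals such that for every transition $(\rho,q)\to\mathcal L:C$ and every $(\rho',q')\in\mathcal L$, either ($\rho\to^*\rho'$ and not $\rho'\to^*\rho$), or ($\rho\to^*\rho'$, $\rho'\to^*\rho$ and $\sigma(q')<_l\sigma(q)$ for all parameter assignments $\sigma$ with $\sigma(C)=\top$). A proof schema proves its end-sequent $\mathrm{Seq}(\rho_0)$: for each parameter assignment $\sigma$, unfolding the definitions yields an $\mathbf{LK}$-proof of $\sigma(\mathrm{Seq}(\rho_0))$. -}

module Defs where

open import Level using (0ℓ)
open import Data.Nat.Base using (ℕ; zero; suc; _+_; pred; _<_; _>_; _≤_; _≥_)
open import Data.Nat.Properties using (_≟_)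
open import Data.Fin.Base using (Fin; zero; suc; toℕ)
open import Data.Bool.Base using (if_then_else_)
open import Data.Empty using (⊥)
open import Data.Unit.Base using (⊤; tt)
open import Data.Product using (Σ; ∃; ∃!; _×_; _,_; proj₁; proj₂)
open import Data.Sum.Base using (_⊎_)
open import Data.Maybe.Base using (Maybe; just; nothing)
open import Data.List.Base using (List; []; _∷_; _++_; map; length; lookup; allFin)
open import Data.List.NonEmpty.Base using (List⁺; _∷_; toList)
open import Data.List.Membership.Propositional using (_∈_)
open import Data.List.Membership.Propositional.Properties using (∈-map⁺; ∈-allFin)
open import Data.List.Properties using (map-∘)
open import Data.List.Relation.Unary.All using (All)
open import Data.List.Relation.Unary.Any using (Any)
open import Data.List.Relation.Binary.Pointwise using (Pointwise)
open import Data.List.Relation.Binary.Permutation.Propositional using (_↭_)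
open import Data.List.Relation.Binary.Subset.Propositional using (_⊆_)
open import Data.Vec.Base as Vec using (Vec; []; _∷_)
import Data.Vec.Relation.Unary.Any as Vec using (Any)
open import Function.Base using (id; _∘_)
open import Function.Bundles using (_⇔_)
open import Function.Definitions using (Injective)
open import Induction.WellFounded using (WellFounded)
open import Relation.Nullary using (¬_; does)
open import Relation.Binary.Core using (Rel)
open import Relation.Binary.Structures using (IsStrictPartialOrder)
open import Relation.Binary.Construct.Closure.Transitive using (TransClosure)
open import Relation.Binary.Construct.Closure.ReflexiveTransitive using (Star)
open import Relation.Binary.PropositionalEquality.Core using (_≡_; _≢_; refl; sym; subst)

------------------------------------------------------------------------
-- First-order syntax, locally nameless: free variables are names in V,
-- bound variables are de Bruijn indices in Fin n.  A formula in the usual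
-- sense has n = 0.

-- Symbols, indexed by arity.
Symbols : Set₁
Symbols = ℕ → Set

data Term (F : Symbols) (V : Set) (n : ℕ) : Set where
  fvar : V → Term F V n
  bvar : Fin n → Term F V n
  fn   : ∀ {k} → F k → Vec (Term F V n) k → Term F V n

infix 9 _⟨_⟩
data Atom (F P : Symbols) (V : Set) (n : ℕ) : Set where
  _⟨_⟩ : ∀ {k} → P k → Vec (Term F V n) k → Atom F P V n

infixr 7 _∧'_
infixr 6 _∨'_
infixr 5 _⇒'_
data Formula (F P : Symbols) (V : Set) (n : ℕ) : Set where
  atom           : Atom F P V n → Formula F P V n
  ¬'_            : Formula F P V n → Formula F P V n
  _∧'_ _∨'_ _⇒'_ : Formula F P V n → Formula F P V n → Formula F P V n
  ∀'_ ∃'_        : Formula F P V (suc n) → Formula F P V n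

module _ {F F′ : Symbols} {V W : Set} (φ : ∀ {k} → F k → F′ k) (ν : V → W) where

  mutual
    mapₜ : ∀ {n} → Term F V n → Term F′ W n
    mapₜ (fvar x)  = fvar (ν x)
    mapₜ (bvar i)  = bvar i
    mapₜ (fn f ts) = fn (φ f) (mapₜₛ ts)

    mapₜₛ : ∀ {n k} → Vec (Term F V n) k → Vec (Term F′ W n) k
    mapₜₛ []       = []
    mapₜₛ (t ∷ ts) = mapₜ t ∷ mapₜₛ ts

  module _ {P P′ : Symbols} (ψ : ∀ {k} → P k → P′ k) where

    mapₐ : ∀ {n} → Atom F P V n → Atom F′ P′ W n
    mapₐ (p ⟨ ts ⟩) = ψ p ⟨ mapₜₛ ts ⟩

    mapᶠ : ∀ {n} → Formula F P V n → Formula F′ P′ W n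
    mapᶠ (atom a) = atom (mapₐ a)
    mapᶠ (¬' A)   = ¬' mapᶠ A
    mapᶠ (A ∧' B) = mapᶠ A ∧' mapᶠ B
    mapᶠ (A ∨' B) = mapᶠ A ∨' mapᶠ B
    mapᶠ (A ⇒' B) = mapᶠ A ⇒' mapᶠ B
    mapᶠ (∀' A)   = ∀' mapᶠ A
    mapᶠ (∃' A)   = ∃' mapᶠ A

-- Simultaneous capture-avoiding substitution, θ for the free variables and
-- β for the dangling bound variables.

module _ {F : Symbols} {V W : Set} where

  mutual
    bindₜ : ∀ {m n} → (V → Term F W n) → (Fin m → Term F W n) →
            Term F V m → Term F W n
    bindₜ θ β (fvar x)  = θ x
    bindₜ θ β (bvar i)  = β i
    bindₜ θ β (fn f ts) = fn f (bindₜₛ θ β ts)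

    bindₜₛ : ∀ {m n k} → (V → Term F W n) → (Fin m → Term F W n) →
             Vec (Term F V m) k → Vec (Term F W n) k
    bindₜₛ θ β []       = []
    bindₜₛ θ β (t ∷ ts) = bindₜ θ β t ∷ bindₜₛ θ β ts

weakenₜ : ∀ {F V n} → Term F V n → Term F V (suc n)
weakenₜ = bindₜ fvar (bvar ∘ suc)

liftᵇ : ∀ {F W m n} → (Fin m → Term F W n) → Fin (suc m) → Term F W (suc n)
liftᵇ β zero    = bvar zero
liftᵇ β (suc i) = weakenₜ (β i)

module _ {F P : Symbols} {V W : Set} where

  bindₐ : ∀ {m n} → (V → Term F W n) → (Fin m → Term F W n) →
          Atom F P V m → Atom F P W n
  bindₐ θ β (p ⟨ ts ⟩) = p ⟨ bindₜₛ θ β ts ⟩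

  bindᶠ : ∀ {m n} → (V → Term F W n) → (Fin m → Term F W n) →
          Formula F P V m → Formula F P W n
  bindᶠ θ β (atom a) = atom (bindₐ θ β a)
  bindᶠ θ β (¬' A)   = ¬' bindᶠ θ β A
  bindᶠ θ β (A ∧' B) = bindᶠ θ β A ∧' bindᶠ θ β B
  bindᶠ θ β (A ∨' B) = bindᶠ θ β A ∨' bindᶠ θ β B
  bindᶠ θ β (A ⇒' B) = bindᶠ θ β A ⇒' bindᶠ θ β B
  bindᶠ θ β (∀' A)   = ∀' bindᶠ (weakenₜ ∘ θ) (liftᵇ β) A
  bindᶠ θ β (∃' A)   = ∃' bindᶠ (weakenₜ ∘ θ) (liftᵇ β) A

module _ {F P : Symbols} {V : Set} where

  infix 8 _[_] _[_]*
  _[_] : Formula F P V 1 → Term F V 0 → Formula F P V 0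
  A [ t ] = bindᶠ fvar (λ _ → t) A

  _[_]* : ∀ {k} → Formula F P V k → Vec (Term F V 0) k → Formula F P V 0
  A [ ts ]* = bindᶠ fvar (Vec.lookup ts) A

module _ {F : Symbols} {V : Set} (x : V) where

  data _∈ₜ_ {n} : Term F V n → Set where
    here : _∈ₜ_ (fvar x)
    arg  : ∀ {k} {f : F k} {ts} → Vec.Any _∈ₜ_ ts → _∈ₜ_ (fn f ts)

  module _ {P : Symbols} where

    OccursIn : ∀ {n} → Formula F P V n → Set
    OccursIn (atom (p ⟨ ts ⟩)) = Vec.Any _∈ₜ_ ts
    OccursIn (¬' A)            = OccursIn A
    OccursIn (A ∧' B)          = OccursIn A ⊎ OccursIn B
    OccursIn (A ∨' B)          = OccursIn A ⊎ OccursIn B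
    OccursIn (A ⇒' B)          = OccursIn A ⊎ OccursIn B
    OccursIn (∀' A)            = OccursIn A
    OccursIn (∃' A)            = OccursIn A

    FreshFor : ∀ {n} → List (Formula F P V n) → Set
    FreshFor = All (λ A → ¬ OccursIn A)

------------------------------------------------------------------------
-- LKID, over function symbols F, ordinary predicate symbols Q and inductive
-- predicate symbols I.

-- The variables of a production are Fin vars; they are schematic.
record Production (F Q I : Symbols) : Set where
  field
    vars              : ℕ
    ordinaryPremises  : List (Atom F Q (Fin vars) 0)
    inductivePremises : List (Atom F I (Fin vars) 0)
    conclusion        : Atom F I (Fin vars) 0

data LKIDPred (Q I : Symbols) : Symbols where
  ord : ∀ {k} → Q k → LKIDPred Q I k
  ind : ∀ {k} → I k → LKIDPred Q I k
  eq  : LKIDPred Q I 2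

module LKID {F Q I : Symbols} (Φ : List (Production F Q I)) where

  open Production

  Tm : Set
  Tm = Term F ℕ 0

  Fm : ℕ → Set
  Fm = Formula F (LKIDPred Q I) ℕ

  infix 4 _≐_
  _≐_ : Tm → Tm → Fm 0
  t ≐ u = atom (eq ⟨ t ∷ u ∷ [] ⟩)

  substᶠ : (ℕ → Tm) → Fm 0 → Fm 0
  substᶠ θ = bindᶠ θ bvar

  substₐ : ∀ {P : Symbols} {v} → (Fin v → Tm) → Atom F P (Fin v) 0 → Atom F P ℕ 0
  substₐ θ = bindₐ θ bvar

  ⌜_⌝ᵒ : Atom F Q ℕ 0 → Fm 0
  ⌜ q ⟨ ts ⟩ ⌝ᵒ = atom (ord q ⟨ ts ⟩)

  ⌜_⌝ⁱ : Atom F I ℕ 0 → Fm 0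
  ⌜ p ⟨ ts ⟩ ⌝ⁱ = atom (ind p ⟨ ts ⟩)

  head : ∀ {V n} → Atom F I V n → ∃ I
  head (p ⟨ _ ⟩) = _ , p

  -- Mutual dependency of inductive predicates: each is reachable from the
  -- other by passing from the conclusion of a production to its premises.

  Prem : ∃ I → ∃ I → Set
  Prem P P′ = Any (λ pr → head (conclusion pr) ≡ P ×
                          Any (λ a → head a ≡ P′) (inductivePremises pr)) Φ

  MutuallyDependent : ∃ I → ∃ I → Set
  MutuallyDependent P P′ = Star Prem P P′ × Star Prem P′ P

  -- G assigns to each inductive predicate of arity k an induction formula
  -- with k holes.
  InductionFormulas : Set
  InductionFormulas = ∀ {k} → I k → Fm k

  generalise : InductionFormulas → Atom F I ℕ 0 → Fm 0
  generalise G (p ⟨ ts ⟩) = G p [ ts ]*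

  -- What an inductive premise becomes in a minor premise of an induction
  -- on P.
  data Hypothesis (G : InductionFormulas) (P : ∃ I) (a : Atom F I ℕ 0) : Fm 0 → Set where
    generalised : MutuallyDependent P (head a)   → Hypothesis G P a (generalise G a)
    unchanged   : ¬ MutuallyDependent P (head a) → Hypothesis G P a ⌜ a ⌝ⁱ

  _[_↦_,_↦_] : List (Fm 0) → ℕ → Tm → ℕ → Tm → List (Fm 0)
  Γ [ x ↦ t , y ↦ u ] =
    map (substᶠ (λ z → if does (z ≟ x) then t else if does (z ≟ y) then u else fvar z)) Γ

  -- The structural rule wk acts up to set inclusion, so sequents are
  -- effectively pairs of finite sets (exchange and contraction included).

  infix 3 _⊢_
  data _⊢_ : List (Fm 0) → List (Fm 0) → Set where
    ax  : ∀ {Γ Δ A} → A ∈ Γ → A ∈ Δ → Γ ⊢ Δ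
    wk  : ∀ {Γ Γ′ Δ Δ′} → Γ′ ⊆ Γ → Δ′ ⊆ Δ → Γ′ ⊢ Δ′ → Γ ⊢ Δ
    cut : ∀ {Γ Δ} A → Γ ⊢ A ∷ Δ → A ∷ Γ ⊢ Δ → Γ ⊢ Δ
    sub : ∀ {Γ Δ} (θ : ℕ → Tm) → Γ ⊢ Δ → map (substᶠ θ) Γ ⊢ map (substᶠ θ) Δ

    ¬l : ∀ {Γ Δ A} → Γ ⊢ A ∷ Δ → ¬' A ∷ Γ ⊢ Δ
    ¬r : ∀ {Γ Δ A} → A ∷ Γ ⊢ Δ → Γ ⊢ ¬' A ∷ Δ
    ∧l : ∀ {Γ Δ A B} → A ∷ B ∷ Γ ⊢ Δ → A ∧' B ∷ Γ ⊢ Δ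
    ∧r : ∀ {Γ Δ A B} → Γ ⊢ A ∷ Δ → Γ ⊢ B ∷ Δ → Γ ⊢ A ∧' B ∷ Δ
    ∨l : ∀ {Γ Δ A B} → A ∷ Γ ⊢ Δ → B ∷ Γ ⊢ Δ → A ∨' B ∷ Γ ⊢ Δ
    ∨r : ∀ {Γ Δ A B} → Γ ⊢ A ∷ B ∷ Δ → Γ ⊢ A ∨' B ∷ Δ
    ⇒l : ∀ {Γ Δ A B} → Γ ⊢ A ∷ Δ → B ∷ Γ ⊢ Δ → (A ⇒' B) ∷ Γ ⊢ Δ
    ⇒r : ∀ {Γ Δ A B} → A ∷ Γ ⊢ B ∷ Δ → Γ ⊢ (A ⇒' B) ∷ Δ
    ∀l : ∀ {Γ Δ A} t → A [ t ] ∷ Γ ⊢ Δ → ∀' A ∷ Γ ⊢ Δ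
    ∀r : ∀ {Γ Δ A} x → FreshFor x (∀' A ∷ Γ ++ Δ) → Γ ⊢ A [ fvar x ] ∷ Δ → Γ ⊢ ∀' A ∷ Δ
    ∃l : ∀ {Γ Δ A} x → FreshFor x (∃' A ∷ Γ ++ Δ) → A [ fvar x ] ∷ Γ ⊢ Δ → ∃' A ∷ Γ ⊢ Δ
    ∃r : ∀ {Γ Δ A} t → Γ ⊢ A [ t ] ∷ Δ → Γ ⊢ ∃' A ∷ Δ

    =l : ∀ {Γ Δ} x y t u → Γ [ x ↦ u , y ↦ t ] ⊢ Δ [ x ↦ u , y ↦ t ] →
         (t ≐ u) ∷ Γ [ x ↦ t , y ↦ u ] ⊢ Δ [ x ↦ t , y ↦ u ]
    =r : ∀ {Γ Δ} t → Γ ⊢ (t ≐ t) ∷ Δ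

    indR : ∀ {Γ Δ pr} → pr ∈ Φ → (θ : Fin (vars pr) → Tm) →
           (∀ {a} → a ∈ ordinaryPremises pr  → Γ ⊢ ⌜ substₐ θ a ⌝ᵒ ∷ Δ) →
           (∀ {a} → a ∈ inductivePremises pr → Γ ⊢ ⌜ substₐ θ a ⌝ⁱ ∷ Δ) →
           Γ ⊢ ⌜ substₐ θ (conclusion pr) ⌝ⁱ ∷ Δ

    -- y pr are the fresh variables replacing the variables of pr, and H pr
    -- the hypotheses from its inductive premises, in the minor premise for pr.
    indL : ∀ {Γ Δ k} {p : I k} {ts}
           (G : InductionFormulas)
           (y : ∀ pr → Fin (vars pr) → ℕ)
           (H : Production F Q I → List (Fm 0)) →
           (∀ {pr} → pr ∈ Φ → MutuallyDependent (k , p) (head (conclusion pr)) →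
              Injective _≡_ _≡_ (y pr) ×
              (∀ i → FreshFor (y pr i) (⌜ p ⟨ ts ⟩ ⌝ⁱ ∷ Γ ++ Δ) ×
                     (∀ {j} (p′ : I j) → MutuallyDependent (k , p) (j , p′) →
                        ¬ OccursIn (y pr i) (G p′))) ×
              Pointwise (Hypothesis G (k , p))
                        (map (substₐ (fvar ∘ y pr)) (inductivePremises pr)) (H pr)) →
           (∀ {pr} → pr ∈ Φ → MutuallyDependent (k , p) (head (conclusion pr)) →
              map (⌜_⌝ᵒ ∘ substₐ (fvar ∘ y pr)) (ordinaryPremises pr) ++ H pr ++ Γ
                ⊢ generalise G (substₐ (fvar ∘ y pr) (conclusion pr)) ∷ Δ) →
           generalise G (p ⟨ ts ⟩) ∷ Γ ⊢ Δ →
           ⌜ p ⟨ ts ⟩ ⌝ⁱ ∷ Γ ⊢ Δ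

------------------------------------------------------------------------
-- The languages.  F and P are the further function and predicate symbols.

-- Zero, successor and the further symbols: the part of the language that is
-- common to schemata and LKID.
data BaseFun (F : Symbols) : Symbols where
  `0 : BaseFun F 0
  `s : BaseFun F 1
  fun : ∀ {k} → F k → BaseFun F k

data 𝒩Fun (F : Symbols) : Symbols where
  base : ∀ {k} → BaseFun F k → 𝒩Fun F k
  `p   : 𝒩Fun F 1

data Cmp : Set where
  eq lt gt le ge : Cmp

data 𝒩Pred (P : Symbols) : Symbols where
  base : ∀ {k} → P k → 𝒩Pred P k
  cmp  : Cmp → 𝒩Pred P 2

data NatPred : Symbols where
  N : NatPred 1

Φ-N : ∀ {F P} → List (Production (BaseFun F) P NatPred)
Φ-N = record { vars = 0 ; ordinaryPremises = [] ; inductivePremises = []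
             ; conclusion = N ⟨ fn `0 [] ∷ [] ⟩ }
    ∷ record { vars = 1 ; ordinaryPremises = []
             ; inductivePremises = N ⟨ fvar zero ∷ [] ⟩ ∷ []
             ; conclusion = N ⟨ fn `s (fvar zero ∷ []) ∷ [] ⟩ }
    ∷ []

-- Parameters are scoped: an object with m parameters has parameter set Fin m,
-- and the i-th component of a parameter tuple is the parameter i itself.
data Var (m : ℕ) : Set where
  par  : Fin m → Var m
  free : ℕ → Var m

data T₀ (m : ℕ) : Set where
  par   : Fin m → T₀ m
  `0    : T₀ m
  `s `p : T₀ m → T₀ m

Assignment : ℕ → Set
Assignment m = Fin m → ℕ

⟦_⟧_ : ∀ {m} → T₀ m → Assignment m → ℕ
⟦ par i ⟧ σ = σ i
⟦ `0 ⟧ σ    = 0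
⟦ `s t ⟧ σ  = suc (⟦ t ⟧ σ)
⟦ `p t ⟧ σ  = pred (⟦ t ⟧ σ)

⌜_⌝ : ∀ {F m n} → T₀ m → Term (𝒩Fun F) (Var m) n
⌜ par i ⌝ = fvar (par i)
⌜ `0 ⌝    = fn (base `0) []
⌜ `s t ⌝  = fn (base `s) (⌜ t ⌝ ∷ [])
⌜ `p t ⌝  = fn `p (⌜ t ⌝ ∷ [])

⟦_⟧ᶜ : Cmp → ℕ → ℕ → Set
⟦ eq ⟧ᶜ = _≡_
⟦ lt ⟧ᶜ = _<_
⟦ gt ⟧ᶜ = _>_
⟦ le ⟧ᶜ = _≤_
⟦ ge ⟧ᶜ = _≥_

data Condition (m : ℕ) : Set where
  ⊤' ⊥'     : Condition m
  ¬'_       : Condition m → Condition m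
  _∧'_ _∨'_ : Condition m → Condition m → Condition m
  -- s^α(v) △ s^β(0)
  numeral   : (α : ℕ) (v : Fin m) → Cmp → (β : ℕ) → Condition m
  -- s^α(v) △ s^β(w)
  compare   : (α : ℕ) (v : Fin m) → Cmp → (β : ℕ) (w : Fin m) → v ≢ w → Condition m

infix 4 _⊨_
_⊨_ : ∀ {m} → Assignment m → Condition m → Set
σ ⊨ ⊤'                  = ⊤
σ ⊨ ⊥'                  = ⊥
σ ⊨ ¬' C                = ¬ (σ ⊨ C)
σ ⊨ C ∧' D              = (σ ⊨ C) × (σ ⊨ D)
σ ⊨ C ∨' D              = (σ ⊨ C) ⊎ (σ ⊨ D)
σ ⊨ numeral α v △ β     = ⟦ △ ⟧ᶜ (α + σ v) β
σ ⊨ compare α v △ β w _ = ⟦ △ ⟧ᶜ (α + σ v) (β + σ w)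

IsPartition : ∀ {m} → List (Condition m) → Set
IsPartition {m} Cs = (σ : Assignment m) → ∃! _≡_ (λ (i : Fin (length Cs)) → σ ⊨ lookup Cs i)

------------------------------------------------------------------------
-- Point transition systems

record Transition (Label : Set) (m : ℕ) : Set where
  field
    condition : Condition m
    targets   : List⁺ (Label × List (T₀ m))

open Transition public

record PointTransitionSystem : Set₁ where
  field
    Label       : Set
    start       : Label
    End         : Label → Set
    arity       : Label → ℕ
    transitions : (δ : Label) → List (Transition Label (arity δ))
    -- Finitely many transitions altogether.
    support     : List Label
    finite      : ∀ δ → transitions δ ≢ [] → δ ∈ support
    partition   : ∀ δ → transitions δ ≢ [] → IsPartition (map condition (transitions δ))
    start-moves : transitions start ≢ []
    end-stuck   : ∀ δ → End δ → transitions δ ≡ []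

  _⟶_ : Rel Label 0ℓ
  δ ⟶ δ′ = Any (λ τ → Any (λ e → proj₁ e ≡ δ′) (toList (targets τ))) (transitions δ)

  _⟶*_ : Rel Label 0ℓ
  _⟶*_ = TransClosure _⟶_

  record IsCanonic : Set₁ where
    field
      _<ₗ_                 : Rel (List ℕ) 0ℓ
      isStrictPartialOrder : IsStrictPartialOrder _≡_ _<ₗ_
      wellFounded          : WellFounded _<ₗ_
      decreasing           :
        ∀ δ {τ} → τ ∈ transitions δ → ∀ {δ′ us} → (δ′ , us) ∈ toList (targets τ) →
        (δ ⟶* δ′ × ¬ (δ′ ⟶* δ)) ⊎
        (δ ⟶* δ′ × δ′ ⟶* δ ×
          (∀ σ → σ ⊨ condition τ → map (⟦_⟧ σ) us <ₗ map σ (allFin (arity δ))))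

------------------------------------------------------------------------
-- Proof schemata

module Schemata (F P : Symbols) where

  𝒩Term : ℕ → Set
  𝒩Term m = Term (𝒩Fun F) (Var m) 0

  𝒩Atom 𝒩Formula : ℕ → Set
  𝒩Atom m    = Atom (𝒩Fun F) (𝒩Pred P) (Var m) 0
  𝒩Formula m = Formula (𝒩Fun F) (𝒩Pred P) (Var m) 0

  record 𝒩Sequent (m : ℕ) : Set where
    constructor _⇛_
    field
      ante succ : List (𝒩Formula m)

  open 𝒩Sequent public

  -- Structures for first-order logic with equality: only = has a fixed
  -- interpretation, 0, s, p and the other comparisons do not.
  record Structure : Set₁ where
    field
      Carrier : Set
      funᴵ    : ∀ {k} → 𝒩Fun F k → Vec Carrier k → Carrier
      predᴵ   : ∀ {k} → 𝒩Pred P k → Vec Carrier k → Set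
      eqᴵ     : ∀ a b → predᴵ (cmp eq) (a ∷ b ∷ []) ⇔ (a ≡ b)

    mutual
      evalₜ : ∀ {V} → (V → Carrier) → Term (𝒩Fun F) V 0 → Carrier
      evalₜ v (fvar x)  = v x
      evalₜ v (fn f ts) = funᴵ f (evalₜₛ v ts)

      evalₜₛ : ∀ {V k} → (V → Carrier) → Vec (Term (𝒩Fun F) V 0) k → Vec Carrier k
      evalₜₛ v []       = []
      evalₜₛ v (t ∷ ts) = evalₜ v t ∷ evalₜₛ v ts

    Holds : ∀ {V} → (V → Carrier) → Atom (𝒩Fun F) (𝒩Pred P) V 0 → Set
    Holds v (p ⟨ ts ⟩) = predᴵ p (evalₜₛ v ts)

  -- Classical validity: no structure and valuation make all of Γ true and
  -- all of Δ false.
  FOLValid : ∀ {m} → List (𝒩Atom m) → List (𝒩Atom m) → Set₁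
  FOLValid {m} Γ Δ = (M : Structure) → let open Structure M in
    (v : Var m → Carrier) → ¬ (All (Holds v) Γ × All (λ a → ¬ Holds v a) Δ)

  record T₀Atom (m : ℕ) : Set where
    constructor comparison
    field
      rel : Cmp
      lhs rhs : T₀ m

  ⌜_⌝ᵗ : ∀ {m} → T₀Atom m → 𝒩Formula m
  ⌜ comparison ∘ t u ⌝ᵗ = atom (cmp ∘ ⟨ ⌜ t ⌝ ∷ ⌜ u ⌝ ∷ [] ⟩)

  _⊨ᵗ_ : ∀ {m} → Assignment m → T₀Atom m → Set
  σ ⊨ᵗ comparison ∘ t u = ⟦ ∘ ⟧ᶜ (⟦ t ⟧ σ) (⟦ u ⟧ σ)

  Entails : ∀ {m} → Condition m → List (T₀Atom m) → List (T₀Atom m) → Set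
  Entails C Γ Δ = ∀ σ → σ ⊨ C → All (σ ⊨ᵗ_) Γ → Any (σ ⊨ᵗ_) Δ

  substPar : ∀ {m r} → Vec (T₀ m) r → Var r → 𝒩Term m
  substPar θ (par i)  = ⌜ Vec.lookup θ i ⌝
  substPar θ (free x) = fvar (free x)

  _⟪_⟫ : ∀ {m r} → List (𝒩Formula r) → Vec (T₀ m) r → List (𝒩Formula m)
  Γ ⟪ θ ⟫ = map (bindᶠ (substPar θ) bvar) Γ

  -- s-proofs over the proof symbols Fin r, for a given condition C: sequent
  -- calculus LK on 𝒩-sequents with C-axioms and calls.  Multisets are lists
  -- with the rule perm; eigenvariables are ordinary free variables.
  module _ {r} (arity : Fin r → ℕ) (Seq : ∀ ρ → 𝒩Sequent (arity ρ)) where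

    data SProof {m} (C : Condition m) : List (𝒩Formula m) → List (𝒩Formula m) → Set₁ where
      call   : ∀ ρ (θ : Vec (T₀ m) (arity ρ)) →
               SProof C (ante (Seq ρ) ⟪ θ ⟫) (succ (Seq ρ) ⟪ θ ⟫)

      taut   : ∀ a → SProof C (atom a ∷ []) (atom a ∷ [])
      fol    : ∀ Γ Δ → FOLValid Γ Δ → SProof C (map atom Γ) (map atom Δ)
      arith  : ∀ Γ Δ → Entails C Γ Δ → SProof C (map ⌜_⌝ᵗ Γ) (map ⌜_⌝ᵗ Δ)

      perm   : ∀ {Γ Γ′ Δ Δ′} → Γ ↭ Γ′ → Δ ↭ Δ′ → SProof C Γ Δ → SProof C Γ′ Δ′
      wl     : ∀ {Γ Δ} A → SProof C Γ Δ → SProof C (A ∷ Γ) Δ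
      wr     : ∀ {Γ Δ} A → SProof C Γ Δ → SProof C Γ (A ∷ Δ)
      cl     : ∀ {Γ Δ A} → SProof C (A ∷ A ∷ Γ) Δ → SProof C (A ∷ Γ) Δ
      cr     : ∀ {Γ Δ A} → SProof C Γ (A ∷ A ∷ Δ) → SProof C Γ (A ∷ Δ)
      cut    : ∀ {Γ Δ Γ′ Δ′} A → SProof C Γ (A ∷ Δ) → SProof C (A ∷ Γ′) Δ′ →
               SProof C (Γ ++ Γ′) (Δ ++ Δ′)

      ¬l     : ∀ {Γ Δ A} → SProof C Γ (A ∷ Δ) → SProof C (¬' A ∷ Γ) Δ
      ¬r     : ∀ {Γ Δ A} → SProof C (A ∷ Γ) Δ → SProof C Γ (¬' A ∷ Δ)
      ∧l     : ∀ {Γ Δ A B} → SProof C (A ∷ B ∷ Γ) Δ → SProof C (A ∧' B ∷ Γ) Δ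
      ∧r     : ∀ {Γ Δ Γ′ Δ′ A B} → SProof C Γ (A ∷ Δ) → SProof C Γ′ (B ∷ Δ′) →
               SProof C (Γ ++ Γ′) (A ∧' B ∷ Δ ++ Δ′)
      ∨l     : ∀ {Γ Δ Γ′ Δ′ A B} → SProof C (A ∷ Γ) Δ → SProof C (B ∷ Γ′) Δ′ →
               SProof C (A ∨' B ∷ Γ ++ Γ′) (Δ ++ Δ′)
      ∨r     : ∀ {Γ Δ A B} → SProof C Γ (A ∷ B ∷ Δ) → SProof C Γ (A ∨' B ∷ Δ)
      ⇒l     : ∀ {Γ Δ Γ′ Δ′ A B} → SProof C Γ (A ∷ Δ) → SProof C (B ∷ Γ′) Δ′ →
               SProof C ((A ⇒' B) ∷ Γ ++ Γ′) (Δ ++ Δ′)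
      ⇒r     : ∀ {Γ Δ A B} → SProof C (A ∷ Γ) (B ∷ Δ) → SProof C Γ ((A ⇒' B) ∷ Δ)
      ∀l     : ∀ {Γ Δ A} t → SProof C (A [ t ] ∷ Γ) Δ → SProof C (∀' A ∷ Γ) Δ
      ∀r     : ∀ {Γ Δ A} x → FreshFor (free x) (∀' A ∷ Γ ++ Δ) →
               SProof C Γ (A [ fvar (free x) ] ∷ Δ) → SProof C Γ (∀' A ∷ Δ)
      ∃l     : ∀ {Γ Δ A} x → FreshFor (free x) (∃' A ∷ Γ ++ Δ) →
               SProof C (A [ fvar (free x) ] ∷ Γ) Δ → SProof C (∃' A ∷ Γ) Δ
      ∃r     : ∀ {Γ Δ A} t → SProof C Γ (A [ t ] ∷ Δ) → SProof C Γ (∃' A ∷ Δ)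

    calls : ∀ {m C Γ Δ} → SProof {m} C Γ Δ → List (Fin r × List (T₀ m))
    calls (call ρ θ)    = (ρ , Vec.toList θ) ∷ []
    calls (taut _)      = []
    calls (fol _ _ _)   = []
    calls (arith _ _ _) = []
    calls (perm _ _ π)  = calls π
    calls (wl _ π)      = calls π
    calls (wr _ π)      = calls π
    calls (cl π)        = calls π
    calls (cr π)        = calls π
    calls (cut _ π π′)  = calls π ++ calls π′
    calls (¬l π)        = calls π
    calls (¬r π)        = calls π
    calls (∧l π)        = calls π
    calls (∧r π π′)     = calls π ++ calls π′
    calls (∨l π π′)     = calls π ++ calls π′
    calls (∨r π)        = calls π
    calls (⇒l π π′)     = calls π ++ calls π′
    calls (⇒r π)        = calls π
    calls (∀l _ π)      = calls π
    calls (∀r _ _ π)    = calls π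
    calls (∃l _ _ π)    = calls π
    calls (∃r _ π)      = calls π

    -- One alternative C : ξ of the definition of ρ.
    record Clause (ρ : Fin r) : Set₁ where
      field
        guard : Condition (arity ρ)
        proof : SProof guard (ante (Seq ρ)) (succ (Seq ρ))

  open Clause public

  record SemiProofSchema : Set₁ where
    field
      size      : ℕ
      ρ₀        : Fin size
      arity     : Fin size → ℕ
      Seq       : ∀ ρ → 𝒩Sequent (arity ρ)
      -- Scoping gives one inclusion between the parameters of Seq ρ and the
      -- parameter set of ρ; this is the other.
      occurs    : ∀ ρ i → Any (OccursIn (par i)) (ante (Seq ρ) ++ succ (Seq ρ))
      Π         : ∀ ρ → List (Clause arity Seq ρ)
      partition : ∀ ρ → IsPartition (map guard (Π ρ))

    -- Labels of the associated system: just ρ for proof symbols ρ, and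
    -- nothing for the end label.

    leaves : ∀ {m} → List (Fin size × List (T₀ m)) → List⁺ (Maybe (Fin size) × List (T₀ m))
    leaves []             = (nothing , map par (allFin _)) ∷ []
    leaves ((ρ , us) ∷ L) = (just ρ , us) ∷ map (λ (ρ′ , us′) → just ρ′ , us′) L

    clauseTransition : ∀ {ρ} → Clause arity Seq ρ → Transition (Maybe (Fin size)) (arity ρ)
    clauseTransition c = record
      { condition = guard c
      ; targets   = leaves (calls arity Seq (proof c)) }

    labelArity : Maybe (Fin size) → ℕ
    labelArity (just ρ) = arity ρ
    labelArity nothing  = 0

    labelTransitions : (δ : Maybe (Fin size)) → List (Transition (Maybe (Fin size)) (labelArity δ))
    labelTransitions (just ρ) = map clauseTransition (Π ρ)
    labelTransitions nothing  = []

    private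
      finite′ : ∀ δ → labelTransitions δ ≢ [] → δ ∈ map just (allFin size)
      finite′ (just ρ) _ = ∈-map⁺ just (∈-allFin ρ)
      finite′ nothing  n with () ← n refl

      partition′ : ∀ δ → labelTransitions δ ≢ [] → IsPartition (map condition (labelTransitions δ))
      partition′ (just ρ) _ = subst IsPartition (map-∘ (Π ρ)) (partition ρ)
      partition′ nothing  n with () ← n refl

      start-moves′ : labelTransitions (just ρ₀) ≢ []
      start-moves′ e with Π ρ₀ | partition ρ₀ (λ _ → 0)
      ... | []    | () , _
      ... | _ ∷ _ | _ with () ← e

    associatedSystem : PointTransitionSystem
    associatedSystem = record
      { Label       = Maybe (Fin size)
      ; start       = just ρ₀
      ; End         = _≡ nothing
      ; arity       = labelArity
      ; transitions = labelTransitions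
      ; support     = map just (allFin size)
      ; finite      = finite′
      ; partition   = partition′
      ; start-moves = start-moves′
      ; end-stuck   = λ { nothing refl → refl ; (just _) () } }

  record ProofSchema : Set₁ where
    field
      semi    : SemiProofSchema
    open SemiProofSchema semi public
    field
      canonic : PointTransitionSystem.IsCanonic associatedSystem

    endSequent : ∃ 𝒩Sequent
    endSequent = arity ρ₀ , Seq ρ₀

------------------------------------------------------------------------
-- Inductive statements: sequents Γ ⇛ Δ universally quantified over natural
-- number parameters.  They use only 0, s and further (uninterpreted) symbols,
-- since the facts about =, <, >, ≤, ≥ and p on the numerals that are built
-- into schemata as axioms are not part of LKID.

record InductiveStatement (F P : Symbols) : Set where
  field
    params    : ℕ
    ante succ : List (Formula (BaseFun F) P (Var params) 0)

module _ {F P : Symbols} (S : InductiveStatement F P) where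

  open InductiveStatement S

  asSchemaSequent : Schemata.𝒩Sequent F P params
  asSchemaSequent = Schemata._⇛_ (map (mapᶠ base id base) ante) (map (mapᶠ base id base) succ)

  ProvableByProofSchema : Set₁
  ProvableByProofSchema =
    Σ ProofSchema λ 𝒫 → ProofSchema.endSequent 𝒫 ≡ (params , asSchemaSequent)
    where open Schemata F P

  -- LKID has one kind of free variable: the parameters become the first
  -- params ones, and are restricted to N in the antecedent.

  variableOf : Var params → ℕ
  variableOf (par i)  = toℕ i
  variableOf (free x) = params + x

  ProvableInLKID : Set
  ProvableInLKID =
    map (λ i → atom (ind N ⟨ fvar (toℕ i) ∷ [] ⟩)) (allFin params) ++
    map (mapᶠ id variableOf ord) ante ⊢ map (mapᶠ id variableOf ord) succ
    where open LKID Φ-N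

{-# OPTIONS --safe #-}
module Submission where

-- The sequent says that R m n follows from R 0 y, R y 0 → R 1 y and
-- R x (1 + y) → R (2 + x) y.  Reading these backwards, every step decreases
-- m + n, so a schema proves it by well-founded recursion.  LKID would have to
-- express this measure, but it has no order.  Precisely: interpret N as all of ℤ
-- and R x y as x + 2y + 1 ≠ 0.  The hypotheses hold, since y = -1 is the fixed
-- point of the jump from 2y + 1 to y, and R 1 (-1) fails.  Yet induction is sound in
-- this model: all formulas are first-order over the group ℤ with a constant 1,
-- and a back-and-forth argument shows that they cannot tell a very negative
-- number from a very large numeral congruent to it modulo many integers.

open import Defs
open import Data.Bool.Base using (true; false; if_then_else_)
open import Data.Empty using (⊥)
open import Data.Fin.Base using (Fin; zero; suc)
open import Data.Fin.Patterns using (0F; 1F; 2F)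
open import Data.Integer.Base as ℤ using (ℤ; +_; -[1+_]; 0ℤ; 1ℤ; -1ℤ; ∣_∣; _+_; _*_; _-_; -_)
open import Data.Integer.Divisibility.Signed using (_∣_; divides; ∣ᵤ⇒∣; ∣n⇒∣m*n; ∣m∣n⇒∣m+n; ∣m⇒∣-m)
import Data.Integer.Properties as ℤ
open import Data.Integer.Tactic.RingSolver using (solve-∀)
open import Data.List.Base as List using (List; []; _∷_; _++_; map)
open import Data.List.Relation.Binary.Permutation.Propositional using (_↭_; ↭-refl; ↭-prep; ↭-swap; ↭-trans)
open import Data.List.Relation.Binary.Pointwise using ([]; _∷_) renaming (Pointwise to Pointwiseᴸ)
open import Data.List.Relation.Unary.All as ListAll using ([]; _∷_)
open import Data.List.Relation.Unary.All.Properties using (anti-mono; map⁺; map⁻; ++⁻ˡ; ++⁻ʳ)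
open import Data.List.Relation.Unary.Any using (here; there)
open import Data.Maybe.Base using (just; nothing)
open import Data.Nat.Base as ℕ using (ℕ; zero; suc; _≤_; _<_; _!; _⊔_; s≤s; z≤n)
import Data.Nat.Divisibility as ℕ
open import Data.Nat.Induction using (<-wellFounded)
open import Data.Nat.ListAction using (sum)
import Data.Nat.Properties as ℕ
open import Data.Product using (Σ; ∃; ∃!; _×_; _,_; proj₁; proj₂)
open import Data.Sum.Base using (inj₁; inj₂)
open import Data.Unit.Base using (⊤; tt)
open import Data.Vec.Base using (Vec; []; _∷_; _∷ʳ_; zipWith; lookup)
open import Data.Vec.Relation.Binary.Pointwise.Inductive using (Pointwise; []; _∷_)
open import Data.Vec.Relation.Unary.All as All using (All; []; _∷_)
import Data.Vec.Relation.Unary.Any as Vec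
open import Function.Bundles using (Equivalence)
open import Relation.Binary.Construct.Closure.ReflexiveTransitive using (ε)
open import Relation.Binary.Construct.Closure.Transitive using (_∷_) renaming ([_] to [_]⁺)
import Relation.Binary.Construct.On as On
open import Relation.Binary.PropositionalEquality
  using (_≡_; _≢_; refl; sym; trans; cong; cong₂; subst; resp₂; isEquivalence; module ≡-Reasoning)
open import Relation.Nullary using (¬_; yes; no; does; contradiction)
open import Relation.Nullary.Decidable using (¬¬-excluded-middle; decidable-stable; dec-true; dec-false)

NoFun : Symbols
NoFun _ = ⊥

data Binary : Symbols where
  R : Binary 2

-- The statement and its proof schema

module _ {V : Set} where

  0' : ∀ {n} → Term (BaseFun NoFun) V n
  0' = fn `0 []

  s' : ∀ {n} → Term (BaseFun NoFun) V n → Term (BaseFun NoFun) V n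
  s' t = fn `s (t ∷ [])

  R' : ∀ {n} → Term (BaseFun NoFun) V n → Term (BaseFun NoFun) V n → Formula (BaseFun NoFun) Binary V n
  R' t u = atom (R ⟨ t ∷ u ∷ [] ⟩)

-- Read backwards, the third hypothesis leads from (2y + 1, 0) to (1, y) by steps of (-2, +1), and
-- the second restarts at (y, 0), which halves 2y + 1. The hypotheses contain no parameters, so a
-- call under any substitution has the same antecedent.
halving : InductiveStatement NoFun Binary
halving = record
  { params = 2
  ; ante   = ∀' R' 0' (bvar 0F)
           ∷ ∀' (R' (bvar 0F) 0' ⇒' R' (s' 0') (bvar 0F))
           ∷ ∀' ∀' (R' (bvar 1F) (s' (bvar 0F)) ⇒' R' (s' (s' (bvar 1F))) (bvar 0F))
           ∷ []
  ; succ   = R' (fvar (par 0F)) (fvar (par 1F)) ∷ []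
  }

open Schemata NoFun Binary

arities : Fin 1 → ℕ
arities _ = 2

sequents : ∀ ρ → 𝒩Sequent (arities ρ)
sequents _ = asSchemaSequent halving

Proof : Condition 2 → List (𝒩Formula 2) → List (𝒩Formula 2) → Set₁
Proof = SProof arities sequents

infix 8 _≗_
_≗_ : T₀ 2 → T₀ 2 → T₀Atom 2
t ≗ u = comparison eq t u

Rel : T₀ 2 → T₀ 2 → 𝒩Atom 2
Rel t u = base R ⟨ ⌜ t ⌝ ∷ ⌜ u ⌝ ∷ [] ⟩

-- Arithmetical rewriting in atoms of `R`

fact : ∀ {C} t u → (∀ σ → σ ⊨ C → ⟦ t ⟧ σ ≡ ⟦ u ⟧ σ) → Proof C [] (⌜ t ≗ u ⌝ᵗ ∷ [])
fact t u h = arith [] (t ≗ u ∷ []) (λ σ c _ → here (h σ c))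

replace : ∀ {C} t t′ u u′ → Proof C (⌜ t′ ≗ t ⌝ᵗ ∷ ⌜ u′ ≗ u ⌝ᵗ ∷ atom (Rel t u) ∷ []) (atom (Rel t′ u′) ∷ [])
replace t t′ u u′ = fol (cmp eq ⟨ ⌜ t′ ⌝ ∷ ⌜ t ⌝ ∷ [] ⟩ ∷ cmp eq ⟨ ⌜ u′ ⌝ ∷ ⌜ u ⌝ ∷ [] ⟩ ∷ Rel t u ∷ []) (Rel t′ u′ ∷ [])
  λ { M v ((p ∷ q ∷ r ∷ []) , (nr ∷ [])) → nr (subst (Structure.predᴵ M (base R)) (sym (cong₂ (λ x y → x ∷ y ∷ [])
      (Equivalence.to (Structure.eqᴵ M _ _) p) (Equivalence.to (Structure.eqᴵ M _ _) q))) r) }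

-- Axioms drawn from the guard only compare terms of `T₀`, whereas atoms of `R` change through
-- first-order equality axioms. Two cuts link them.
convert : ∀ {C} t t′ u u′ → (∀ σ → σ ⊨ C → ⟦ t′ ⟧ σ ≡ ⟦ t ⟧ σ) → (∀ σ → σ ⊨ C → ⟦ u′ ⟧ σ ≡ ⟦ u ⟧ σ) →
          Proof C (atom (Rel t u) ∷ []) (atom (Rel t′ u′) ∷ [])
convert t t′ u u′ ht hu = cut _ (fact u′ u hu) (cut _ (fact t′ t ht) (replace t t′ u u′))

pattern 𝕞 = par 0F
pattern 𝕟 = par 1F

𝕞=0 𝕞=1 𝕞≥2 : Condition 2
𝕞=0 = numeral 0 0F eq 0
𝕞=1 = numeral 0 0F eq 1
𝕞≥2 = numeral 0 0F ge 2

private variable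
  A₁ A₂ A₃ : 𝒩Formula 2

first₂ : A₂ ∷ A₁ ∷ A₃ ∷ [] ↭ A₁ ∷ A₂ ∷ A₃ ∷ []
first₂ {A₂} {A₁} = ↭-swap A₂ A₁ ↭-refl

first₃ : A₃ ∷ A₁ ∷ A₂ ∷ [] ↭ A₁ ∷ A₂ ∷ A₃ ∷ []
first₃ {A₃} {A₁} {A₂} = ↭-trans (↭-swap A₃ A₁ ↭-refl) (↭-prep A₁ (↭-swap A₃ A₂ ↭-refl))

-- `∀l` consumes its formula and `⇒l` splits the context, yet a call needs all three hypotheses.
-- Hence the hypothesis to be instantiated is duplicated first.
contract₂ : ∀ {C Δ} → Proof C (A₂ ∷ A₁ ∷ A₂ ∷ A₃ ∷ []) Δ → Proof C (A₁ ∷ A₂ ∷ A₃ ∷ []) Δ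
contract₂ {A₂} {A₁} π = perm first₂ ↭-refl (cl (perm (↭-prep A₂ (↭-swap A₁ A₂ ↭-refl)) ↭-refl π))

contract₃ : ∀ {C Δ} → Proof C (A₃ ∷ A₁ ∷ A₂ ∷ A₃ ∷ []) Δ → Proof C (A₁ ∷ A₂ ∷ A₃ ∷ []) Δ
contract₃ {A₃} {A₁} {A₂} π = perm first₃ ↭-refl (cl (perm
  (↭-prep A₃ (↭-trans (↭-prep A₁ (↭-swap A₂ A₃ ↭-refl)) (↭-swap A₁ A₃ ↭-refl))) ↭-refl π))

SequentProof : Condition 2 → Set₁
SequentProof C = Proof C (ante (asSchemaSequent halving)) (succ (asSchemaSequent halving))

proof₀ : SequentProof 𝕞=0
proof₀ = ∀l ⌜ 𝕟 ⌝ (perm (↭-trans (↭-prep _ (↭-swap _ _ ↭-refl)) (↭-swap _ _ ↭-refl)) ↭-refl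
  (wl _ (wl _ (convert `0 𝕞 𝕟 𝕟 (λ _ c → c) (λ _ _ → refl)))))

proof₁ : SequentProof 𝕞=1
proof₁ = contract₂ (∀l ⌜ 𝕟 ⌝ (⇒l (call 0F (𝕟 ∷ `0 ∷ []))
  (convert (`s `0) 𝕞 𝕟 𝕟 (λ _ c → c) (λ _ _ → refl))))

suc-suc-pred-pred : ∀ {k} → 2 ≤ k → k ≡ suc (suc (ℕ.pred (ℕ.pred k)))
suc-suc-pred-pred (s≤s (s≤s _)) = refl

proof₂ : SequentProof 𝕞≥2
-- The instance is taken at m - 2; the guard ensures that two successors lead back to m.
proof₂ = contract₃ (∀l ⌜ `p (`p 𝕞) ⌝ (∀l ⌜ 𝕟 ⌝ (⇒l (call 0F (`p (`p 𝕞) ∷ `s 𝕟 ∷ []))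
  (convert (`s (`s (`p (`p 𝕞)))) 𝕞 𝕟 𝕟 (λ _ → suc-suc-pred-pred) (λ _ _ → refl)))))

guards-partition : IsPartition (𝕞=0 ∷ 𝕞=1 ∷ 𝕞≥2 ∷ [])
guards-partition σ = cases (σ 0F) refl
  where
  cases : ∀ k → σ 0F ≡ k → ∃! _≡_ (λ i → σ ⊨ List.lookup (𝕞=0 ∷ 𝕞=1 ∷ 𝕞≥2 ∷ []) i)
  cases 0 e = 0F , e , λ
    { {0F} _ → refl
    ; {1F} c → contradiction (trans (sym e) c) λ ()
    ; {2F} c → contradiction (subst (2 ≤_) e c) λ ()
    }
  cases 1 e = 1F , e , λ
    { {0F} c → contradiction (trans (sym e) c) λ ()
    ; {1F} _ → refl
    ; {2F} c → contradiction (subst (2 ≤_) e c) λ { (s≤s ()) }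
    }
  cases (suc (suc k)) e = 2F , subst (2 ≤_) (sym e) (s≤s (s≤s z≤n)) , λ
    { {0F} c → contradiction (trans (sym e) c) λ ()
    ; {1F} c → contradiction (trans (sym e) c) λ ()
    ; {2F} _ → refl
    }

-- The schema and its termination measure

halving-schema : SemiProofSchema
halving-schema = record
  { size      = 1
  ; ρ₀        = 0F
  ; arity     = arities
  ; Seq       = sequents
  ; occurs    = λ _ → λ where
      0F → there (there (there (here (Vec.here here))))
      1F → there (there (there (here (Vec.there (Vec.here here)))))
  ; Π         = λ { 0F → record { proof = proof₀ } ∷ record { proof = proof₁ } ∷ record { proof = proof₂ } ∷ [] }
  ; partition = λ { 0F → guards-partition }
  }

halving-canonic : PointTransitionSystem.IsCanonic (SemiProofSchema.associatedSystem halving-schema)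
halving-canonic = record
  { _<ₗ_                 = λ us vs → sum us < sum vs
  ; isStrictPartialOrder = record
    { isEquivalence = isEquivalence
    ; irrefl        = λ { refl → ℕ.<-irrefl refl }
    ; trans         = ℕ.<-trans
    ; <-resp-≈      = resp₂ _
    }
  ; wellFounded          = On.wellFounded sum <-wellFounded
  ; decreasing           = λ where
      -- `proof₀` makes no call, so it leads to the end label, from which there is no way back.
      (just 0F) (here refl)                 (here refl) → inj₁ ([ here (here refl) ]⁺ , end-stuck)
      (just 0F) (there (here refl))         (here refl) → inj₂ (loop , loop , λ σ → decreasing₁ (σ 0F) (σ 1F))
      (just 0F) (there (there (here refl))) (here refl) → inj₂ (loop , loop , λ σ → decreasing₂ (σ 0F) (σ 1F))
  }
  where
  open PointTransitionSystem (SemiProofSchema.associatedSystem halving-schema) using (_⟶*_)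

  end-stuck : ∀ {δ} → ¬ (nothing ⟶* δ)
  end-stuck [ () ]⁺
  end-stuck (() ∷ _)

  loop : just 0F ⟶* just 0F
  loop = [ there (here (here refl)) ]⁺

  -- The call from (1, n) to (n, 0) lowers the sum by one; the summand 0 is the sum of the empty
  -- list.
  decreasing₁ : ∀ i j → i ≡ 1 → j ℕ.+ 0 < i ℕ.+ (j ℕ.+ 0)
  decreasing₁ .1 j refl = ℕ.≤-refl

  -- The call from (m, n) to (m - 2, n + 1) also lowers the sum by one.
  decreasing₂ : ∀ i j → 2 ≤ i → ℕ.pred (ℕ.pred i) ℕ.+ suc (j ℕ.+ 0) < i ℕ.+ (j ℕ.+ 0)
  decreasing₂ (suc (suc i)) j (s≤s (s≤s _)) = ℕ.≤-reflexive (cong suc (ℕ.+-suc i (j ℕ.+ 0)))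

halving-provable : ProvableByProofSchema halving
halving-provable = record { semi = halving-schema ; canonic = halving-canonic } , refl

-- Linear forms over ℤ

private variable
  k m n M L : ℕ

dot : Vec ℤ n → Vec ℤ n → ℤ
dot []       []       = 0ℤ
dot (c ∷ cs) (x ∷ xs) = c * x + dot cs xs

combine : ℤ → Vec ℤ n → ℤ → Vec ℤ n → Vec ℤ n
combine k cs l ds = zipWith (λ c d → k * c + l * d) cs ds

dot-combine : ∀ k (cs : Vec ℤ n) l ds xs →
              dot (combine k cs l ds) xs ≡ k * dot cs xs + l * dot ds xs
dot-combine k []       l []       []       = lemma k l
  where
  lemma : ∀ k l → 0ℤ ≡ k * 0ℤ + l * 0ℤ
  lemma = solve-∀
dot-combine k (c ∷ cs) l (d ∷ ds) (x ∷ xs) = trans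
  (cong (λ z → (k * c + l * d) * x + z) (dot-combine k cs l ds xs))
  (lemma k c l d x (dot cs xs) (dot ds xs))
  where
  lemma : ∀ k c l d x C D → (k * c + l * d) * x + (k * C + l * D) ≡ k * (c * x + C) + l * (d * x + D)
  lemma = solve-∀

dot-cong-mod : ∀ {d} (cs : Vec ℤ n) {xs ys} → Pointwise (λ x y → d ∣ x - y) xs ys →
               d ∣ dot cs xs - dot cs ys
dot-cong-mod     []       []       = divides 0ℤ refl
dot-cong-mod {d = d} (c ∷ cs) {x ∷ xs} {y ∷ ys} (p ∷ ps) = subst (d ∣_)
  (lemma c x y (dot cs xs) (dot cs ys))
  (∣m∣n⇒∣m+n (∣n⇒∣m*n c p) (dot-cong-mod cs ps))
  where
  lemma : ∀ c x y X Y → c * (x - y) + (X - Y) ≡ c * x + X - (c * y + Y)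
  lemma = solve-∀

Small : ℕ → Vec ℤ n → Set
Small L = All (λ c → ∣ c ∣ ≤ L)

norm : Vec ℤ n → ℕ
norm []       = 0
norm (x ∷ xs) = ∣ x ∣ ℕ.+ norm xs

∣dot∣≤ : ∀ {cs : Vec ℤ n} → Small L cs → ∀ xs → ∣ dot cs xs ∣ ≤ L ℕ.* norm xs
∣dot∣≤ []               []       = z≤n
∣dot∣≤ {L = L} {cs = c ∷ cs} (p ∷ ps) (x ∷ xs) = begin
  ∣ c * x + dot cs xs ∣              ≤⟨ ℤ.∣i+j∣≤∣i∣+∣j∣ (c * x) (dot cs xs) ⟩
  ∣ c * x ∣ ℕ.+ ∣ dot cs xs ∣        ≡⟨ cong (ℕ._+ _) (ℤ.abs-* c x) ⟩
  ∣ c ∣ ℕ.* ∣ x ∣ ℕ.+ ∣ dot cs xs ∣  ≤⟨ ℕ.+-mono-≤ (ℕ.*-monoˡ-≤ ∣ x ∣ p) (∣dot∣≤ ps xs) ⟩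
  L ℕ.* ∣ x ∣ ℕ.+ L ℕ.* norm xs      ≡⟨ ℕ.*-distribˡ-+ L ∣ x ∣ (norm xs) ⟨
  L ℕ.* (∣ x ∣ ℕ.+ norm xs)          ∎
  where open ℕ.≤-Reasoning

small-combine : ∀ k l {cs ds : Vec ℤ n} → ∣ k ∣ ≤ L → ∣ l ∣ ≤ L → Small L cs → Small L ds →
                Small (L ℕ.* L ℕ.+ L ℕ.* L) (combine k cs l ds)
small-combine k l k≤ l≤ []       []       = []
small-combine {L = L} k l {c ∷ _} {d ∷ _} k≤ l≤ (c≤ ∷ cs≤) (d≤ ∷ ds≤) = head ∷ small-combine k l k≤ l≤ cs≤ ds≤
  where
  open ℕ.≤-Reasoning
  head : ∣ k * c + l * d ∣ ≤ L ℕ.* L ℕ.+ L ℕ.* L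
  head = begin
    ∣ k * c + l * d ∣                      ≤⟨ ℤ.∣i+j∣≤∣i∣+∣j∣ (k * c) (l * d) ⟩
    ∣ k * c ∣ ℕ.+ ∣ l * d ∣                ≡⟨ cong₂ ℕ._+_ (ℤ.abs-* k c) (ℤ.abs-* l d) ⟩
    ∣ k ∣ ℕ.* ∣ c ∣ ℕ.+ ∣ l ∣ ℕ.* ∣ d ∣    ≤⟨ ℕ.+-mono-≤ (ℕ.*-mono-≤ k≤ c≤) (ℕ.*-mono-≤ l≤ d≤) ⟩
    L ℕ.* L ℕ.+ L ℕ.* L                    ∎

-- Approximate indiscernibility in the group ℤ

Congruent : ℕ → ℤ → ℤ → Set
Congruent L x y = ∀ d → d ≢ 0ℤ → ∣ d ∣ ≤ L → d ∣ x - y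

infix 4 _≈[_]_
-- A finite approximation to having the same first-order type in the group ℤ. The residues control
-- divisibility, and thereby whether a linear equation over the tuple has an integer solution.
record _≈[_]_ (xs : Vec ℤ n) (L : ℕ) (ys : Vec ℤ n) : Set where
  field
    relationsˡ : ∀ cs → Small L cs → dot cs xs ≡ 0ℤ → dot cs ys ≡ 0ℤ
    relationsʳ : ∀ cs → Small L cs → dot cs ys ≡ 0ℤ → dot cs xs ≡ 0ℤ
    congruent  : Pointwise (Congruent L) xs ys

open _≈[_]_

private variable
  xs ys : Vec ℤ n
  a b : ℤ

∣-minus-comm : ∀ {d} x y → d ∣ x - y → d ∣ y - x
∣-minus-comm {d} x y p = subst (d ∣_) (lemma x y) (∣m⇒∣-m p)
  where
  lemma : ∀ x y → - (x - y) ≡ y - x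
  lemma = solve-∀

pointwise-sym : Pointwise (Congruent L) xs ys → Pointwise (Congruent L) ys xs
pointwise-sym []       = []
pointwise-sym {xs = x ∷ _} {ys = y ∷ _} (p ∷ ps) =
  (λ d d≢0 d≤L → ∣-minus-comm x y (p d d≢0 d≤L)) ∷ pointwise-sym ps

pointwise-refl : (xs : Vec ℤ n) → Pointwise (Congruent L) xs xs
pointwise-refl []       = []
pointwise-refl (x ∷ xs) = (λ d _ _ → divides 0ℤ (ℤ.+-inverseʳ x)) ∷ pointwise-refl xs

pointwise-map : {R S : ℤ → ℤ → Set} → (∀ {x y} → R x y → S x y) → Pointwise R xs ys → Pointwise S xs ys
pointwise-map f []       = []
pointwise-map f (p ∷ ps) = f p ∷ pointwise-map f ps

≈-sym : xs ≈[ L ] ys → ys ≈[ L ] xs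
≈-sym r .relationsˡ = relationsʳ r
≈-sym r .relationsʳ = relationsˡ r
≈-sym r .congruent  = pointwise-sym (congruent r)

≈-refl : (xs : Vec ℤ n) → xs ≈[ L ] xs
≈-refl xs .relationsˡ _ _ p = p
≈-refl xs .relationsʳ _ _ p = p
≈-refl xs .congruent = pointwise-refl xs

small-mono : M ≤ L → ∀ {cs : Vec ℤ n} → Small M cs → Small L cs
small-mono M≤L = All.map (λ p → ℕ.≤-trans p M≤L)

≈-mono : M ≤ L → xs ≈[ L ] ys → xs ≈[ M ] ys
≈-mono M≤L r .relationsˡ cs s = relationsˡ r cs (small-mono M≤L s)
≈-mono M≤L r .relationsʳ cs s = relationsʳ r cs (small-mono M≤L s)
≈-mono M≤L r .congruent = pointwise-map (λ p d d≢0 d≤M → p d d≢0 (ℕ.≤-trans d≤M M≤L)) (congruent r)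

∣! : ∀ d → d ≢ 0ℤ → ∣ d ∣ ≤ L → d ∣ + (L !)
∣! d d≢0 d≤L = ∣ᵤ⇒∣ (ℕ.∣-trans (n∣n! ∣ d ∣ (λ e → d≢0 (ℤ.∣i∣≡0⇒i≡0 e))) (ℕ.m≤n⇒m!∣n! d≤L))
  where
  n∣n! : ∀ n → n ≢ 0 → n ℕ.∣ n !
  n∣n! zero    n≢0 = contradiction refl n≢0
  n∣n! (suc n) _   = ℕ.m∣m*n (n !)

congruent-shift : ∀ a t → Congruent L a (a + t * + (L !))
congruent-shift {L} a t d d≢0 d≤L = subst (d ∣_) (lemma a t (+ (L !))) (∣n⇒∣m*n (- t) (∣! d d≢0 d≤L))
  where
  lemma : ∀ a t f → - t * f ≡ a - (a + t * f)
  lemma = solve-∀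

-- Extending related tuples by one element

Independent : ℕ → ℤ → Vec ℤ n → Set
Independent L a xs = ∀ c cs → c ≢ 0ℤ → Small L (c ∷ cs) → dot (c ∷ cs) (a ∷ xs) ≢ 0ℤ

-- The term c * b is at least as large as b in absolute value, while the rest of the form is bounded
-- by L * `norm ys`, so the two cannot cancel.
large⇒independent : ∀ b (ys : Vec ℤ n) → L ℕ.* norm ys < ∣ b ∣ → Independent L b ys
large⇒independent {L = L} b ys large c cs c≢0 (_ ∷ small) vanishes = ℕ.<-irrefl refl (begin-strict
  L ℕ.* norm ys    <⟨ large ⟩
  ∣ b ∣            ≤⟨ ℕ.m≤n*m ∣ b ∣ ∣ c ∣ ⟩
  ∣ c ∣ ℕ.* ∣ b ∣  ≡⟨ ℤ.abs-* c b ⟨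
  ∣ c * b ∣        ≡⟨ cong ∣_∣ (lemma (c * b) (dot cs ys)) ⟩
  ∣ c * b + dot cs ys - dot cs ys ∣ ≡⟨ cong (λ z → ∣ z - dot cs ys ∣) vanishes ⟩
  ∣ 0ℤ - dot cs ys ∣ ≡⟨ cong ∣_∣ (ℤ.+-identityˡ (- dot cs ys)) ⟩
  ∣ - dot cs ys ∣    ≡⟨ ℤ.∣-i∣≡∣i∣ (dot cs ys) ⟩
  ∣ dot cs ys ∣      ≤⟨ ∣dot∣≤ small ys ⟩
  L ℕ.* norm ys      ∎)
  where
  open ℕ.≤-Reasoning
  instance _ = ℕ.≢-nonZero (λ e → c≢0 (ℤ.∣i∣≡0⇒i≡0 e))
  lemma : ∀ x y → x ≡ x + y - y
  lemma = solve-∀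

0*x+y : ∀ x y → 0ℤ * x + y ≡ y
0*x+y = solve-∀

-- Only relations with leading coefficient 0 can hold on either side, and these concern `xs` and
-- `ys` alone.
extend-independent : Independent L a xs → Independent L b ys → Congruent L a b →
                     xs ≈[ L ] ys → (a ∷ xs) ≈[ L ] (b ∷ ys)
extend-independent {a = a} {xs = xs} {b = b} {ys = ys} ia ib a≡b r = record
  { relationsˡ = half ia (relationsˡ r)
  ; relationsʳ = half ib (relationsʳ r)
  ; congruent  = a≡b ∷ congruent r
  }
  where
  half : ∀ {n L a b} {xs ys : Vec ℤ n} → Independent L a xs →
         (∀ cs → Small L cs → dot cs xs ≡ 0ℤ → dot cs ys ≡ 0ℤ) →
         ∀ cs → Small L cs → dot cs (a ∷ xs) ≡ 0ℤ → dot cs (b ∷ ys) ≡ 0ℤ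
  half {a = a} {b} {xs} {ys} ia f (c ∷ cs) (p ∷ ps) e with c ℤ.≟ 0ℤ
  ... | no c≢0   = contradiction e (ia c cs c≢0 (p ∷ ps))
  ... | yes refl = trans (0*x+y b (dot cs ys)) (f cs ps (trans (sym (0*x+y a (dot cs xs))) e))

-- Cross-multiplication with the relation satisfied by a cancels a from the second form.
eliminate : ∀ a c d (cs ds xs : Vec ℤ n) → dot (c ∷ cs) (a ∷ xs) ≡ 0ℤ →
            dot (combine c ds (- d) cs) xs ≡ c * dot (d ∷ ds) (a ∷ xs)
eliminate a c d cs ds xs vanishes = begin
  dot (combine c ds (- d) cs) xs                ≡⟨ dot-combine c ds (- d) cs xs ⟩
  c * dot ds xs + - d * dot cs xs               ≡⟨ lemma a c d (dot cs xs) (dot ds xs) ⟩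
  c * (d * a + dot ds xs) + - d * (c * a + dot cs xs) ≡⟨ cong (λ z → c * (d * a + dot ds xs) + - d * z) vanishes ⟩
  c * (d * a + dot ds xs) + - d * 0ℤ            ≡⟨ lemma′ d (c * (d * a + dot ds xs)) ⟩
  c * (d * a + dot ds xs) ∎
  where
  open ≡-Reasoning
  lemma : ∀ a c d C D → c * D + - d * C ≡ c * (d * a + D) + - d * (c * a + C)
  lemma = solve-∀
  lemma′ : ∀ d x → x + - d * 0ℤ ≡ x
  lemma′ = solve-∀

-- Multiplied by c, any relation on the extended tuple reduces to one on `xs` with coefficients up
-- to 2L². This transfers to `ys`, and c can be cancelled again since it is nonzero.
extend-dependent : ∀ c (cs : Vec ℤ n) → c ≢ 0ℤ → Small L (c ∷ cs) →
                   dot (c ∷ cs) (a ∷ xs) ≡ 0ℤ → dot (c ∷ cs) (b ∷ ys) ≡ 0ℤ →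
                   Congruent L a b → L ℕ.* L ℕ.+ L ℕ.* L ≤ M → L ≤ M → xs ≈[ M ] ys → (a ∷ xs) ≈[ L ] (b ∷ ys)
extend-dependent {L = L} {a = a} {xs = xs} {b = b} {ys = ys} {M = M} c cs c≢0 (c≤ ∷ cs≤) ea eb a≡b 2L²≤M L≤M r = record
  { relationsˡ = half ea eb (relationsˡ r)
  ; relationsʳ = half eb ea (relationsʳ r)
  ; congruent  = a≡b ∷ congruent (≈-mono L≤M r)
  }
  where
  half : ∀ {a b xs ys} → dot (c ∷ cs) (a ∷ xs) ≡ 0ℤ → dot (c ∷ cs) (b ∷ ys) ≡ 0ℤ →
         (∀ ds → Small M ds → dot ds xs ≡ 0ℤ → dot ds ys ≡ 0ℤ) →
         ∀ ds → Small L ds → dot ds (a ∷ xs) ≡ 0ℤ → dot ds (b ∷ ys) ≡ 0ℤ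
  half {a} {b} {xs} {ys} ea eb f (d ∷ ds) (d≤ ∷ ds≤) e with ℤ.i*j≡0⇒i≡0∨j≡0 c (trans (sym (eliminate b c d cs ds ys eb)) vanish)
    where
    vanish : dot (combine c ds (- d) cs) ys ≡ 0ℤ
    vanish = f (combine c ds (- d) cs)
      (small-mono 2L²≤M (small-combine c (- d) c≤ (subst (_≤ L) (sym (ℤ.∣-i∣≡∣i∣ d)) d≤) ds≤ cs≤))
      (trans (eliminate a c d cs ds xs ea) (trans (cong (c *_) e) (ℤ.*-zeroʳ c)))
  ... | inj₁ c≡0 = contradiction c≡0 c≢0
  ... | inj₂ p   = p

-- One quantifier costs 2L² for coefficients after elimination, L * L! for the modulus c * L!, and L
-- to retain the old level.
refine : ℕ → ℕ
refine L = L ℕ.* L ℕ.+ L ℕ.* L ℕ.+ L ℕ.* L ! ℕ.+ L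

≤shift : ∀ L e → e ≤ e ℕ.* L !
≤shift L e = ℕ.m≤m*n e (L !) where instance _ = L ℕ.!≢0

shift-large : ∀ L B e t → B ℕ.+ ∣ e ∣ < ∣ t ∣ → B < ∣ e + t * + (L !) ∣
shift-large L B e t B+e<t = ℕ.+-cancelʳ-< ∣ e ∣ B _ (begin-strict
  B ℕ.+ ∣ e ∣                                       <⟨ B+e<t ⟩
  ∣ t ∣                                             ≤⟨ ≤shift L ∣ t ∣ ⟩
  ∣ t ∣ ℕ.* L !                                     ≡⟨ ℤ.abs-* t (+ (L !)) ⟨
  ∣ t * + (L !) ∣                                   ≡⟨ cong ∣_∣ (lemma e (t * + (L !))) ⟩
  ∣ e + t * + (L !) - e ∣                           ≤⟨ ℤ.∣i-j∣≤∣i∣+∣j∣ (e + t * + (L !)) e ⟩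
  ∣ e + t * + (L !) ∣ ℕ.+ ∣ e ∣                     ∎)
  where
  open ℕ.≤-Reasoning
  lemma : ∀ e x → x ≡ e + x - e
  lemma = solve-∀

-- If a satisfies a small relation over `xs`, then b must solve the same relation over `ys`;
-- otherwise any huge b with the residues of a will do. The double negation stems from this case
-- distinction and is harmless because satisfaction is stable.
back-and-forth : ∀ (xs ys : Vec ℤ n) → xs ≈[ refine L ] ys → ∀ a → ¬ ¬ ∃ λ b → (a ∷ xs) ≈[ L ] (b ∷ ys)
back-and-forth {n = n} {L = L} xs ys r a none = ¬¬-excluded-middle {A = Dependent} λ where
    (yes (c , cs , c≢0 , small , ea)) → dependent c cs c≢0 small ea
    (no indep) → none (a + t * + (L !) , extend-independent
      (λ c cs c≢0 small e → indep (c , cs , c≢0 , small , e))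
      (large⇒independent (a + t * + (L !)) ys (shift-large L (L ℕ.* norm ys) a t ℕ.≤-refl))
      (congruent-shift a t) (≈-mono L≤ r))
  where
  Dependent : Set
  Dependent = ∃ λ c → ∃ λ cs → c ≢ 0ℤ × Small L (c ∷ cs) × dot (c ∷ cs) (a ∷ xs) ≡ 0ℤ

  t : ℤ
  -- Large enough for the shift by t * L! to outweigh both a and the bound for relations with `ys`.
  t = + suc (L ℕ.* norm ys ℕ.+ ∣ a ∣)

  L≤ : L ≤ refine L
  L≤ = ℕ.m≤n+m L _

  L*L!≤ : L ℕ.* L ! ≤ refine L
  L*L!≤ = ℕ.≤-trans (ℕ.m≤n+m (L ℕ.* L !) (L ℕ.* L ℕ.+ L ℕ.* L)) (ℕ.m≤m+n _ L)

  2L²≤ : L ℕ.* L ℕ.+ L ℕ.* L ≤ refine L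
  2L²≤ = ℕ.≤-trans (ℕ.m≤m+n _ (L ℕ.* L !)) (ℕ.m≤m+n _ L)

  dependent : ∀ c (cs : Vec ℤ n) → c ≢ 0ℤ → Small L (c ∷ cs) → ¬ dot (c ∷ cs) (a ∷ xs) ≡ 0ℤ
  dependent c cs c≢0 small@(c≤ ∷ _) ea
    -- The modulus is c * L! rather than c, so that after division by c the correction to a is still
    -- a multiple of L!.
    with dot-cong-mod cs (pointwise-map (λ p → p (c * + (L !)) modulus≢0 modulus≤) (congruent r))
    where
    modulus≢0 : c * + (L !) ≢ 0ℤ
    modulus≢0 e with ℤ.i*j≡0⇒i≡0∨j≡0 c e
    ... | inj₁ c≡0 = c≢0 c≡0
    ... | inj₂ f≡0 = ℕ.≢-nonZero⁻¹ (L !) {{L ℕ.!≢0}} (ℤ.+-injective f≡0)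
    modulus≤ : ∣ c * + (L !) ∣ ≤ refine L
    modulus≤ = ℕ.≤-trans (ℕ.≤-reflexive (ℤ.abs-* c (+ (L !)))) (ℕ.≤-trans (ℕ.*-monoˡ-≤ (L !) c≤) L*L!≤)
  -- Since the forms on `xs` and `ys` differ by q * (c * L!), moving a by q * L! compensates
  -- exactly.
  ... | divides q e = none (a + q * + (L !) ,
      extend-dependent c cs c≢0 small ea eb (congruent-shift a q) 2L²≤ L≤ r)
    where
    open ≡-Reasoning
    lemma : ∀ a c q f X Y → c * (a + q * f) + Y ≡ (c * a + X) + (q * (c * f) - (X - Y))
    lemma = solve-∀
    eb : dot (c ∷ cs) (a + q * + (L !) ∷ ys) ≡ 0ℤ
    eb = begin
      c * (a + q * + (L !)) + dot cs ys ≡⟨ lemma a c q (+ (L !)) (dot cs xs) (dot cs ys) ⟩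
      (c * a + dot cs xs) + (q * (c * + (L !)) - (dot cs xs - dot cs ys)) ≡⟨ cong₂ (λ z w → z + (q * (c * + (L !)) - w)) ea e ⟩
      0ℤ + (q * (c * + (L !)) - q * (c * + (L !))) ≡⟨ ℤ.+-identityˡ _ ⟩
      q * (c * + (L !)) - q * (c * + (L !)) ≡⟨ ℤ.+-inverseʳ (q * (c * + (L !))) ⟩
      0ℤ ∎

-- The induction principle

Invariant : ℕ → (ℤ → Set) → Set
Invariant L D = ∀ {a b} → (a ∷ 1ℤ ∷ []) ≈[ L ] (b ∷ 1ℤ ∷ []) → D a → D b

nonneg-shift : ∀ e m → ∣ e ∣ ≤ m → ∃ λ j → e + + m ≡ + j
nonneg-shift (+ i)    m _   = i ℕ.+ m , refl
nonneg-shift -[1+ i ] m i<m = m ℕ.∸ suc i , ℤ.⊖-≥ i<m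

-- With w large, e - w (L !) and e + w (L !) cannot be told apart by D, and the
-- latter is a numeral; from the former D climbs up to e.
ℤ-induction : {D : ℤ → Set} → Invariant L D → D 0ℤ → (∀ a → D a → D (1ℤ + a)) → ∀ e → D e
ℤ-induction {L} {D} invariant D0 Ds e =
  subst D (trans (cong (λ z → e + - + w * + (L !) + z) (ℤ.pos-* w (L !))) (cancel e (+ w) (+ (L !)))) (climb (w ℕ.* L !) low)
  where
  w B : ℕ
  B = L ℕ.* norm (1ℤ ∷ [])
  -- Exceeding B + |e| makes both shifts of e independent of the constant 1, and makes the upper one
  -- nonnegative.
  w = suc (B ℕ.+ ∣ e ∣)

  climb : ∀ {a} j → D a → D (a + + j)
  climb {a} zero    p = subst D (sym (ℤ.+-identityʳ a)) p
  climb {a} (suc j) p = subst D (lemma a (+ j)) (Ds _ (climb j p))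
    where
    lemma : ∀ a j → 1ℤ + (a + j) ≡ a + (1ℤ + j)
    lemma = solve-∀

  cancel : ∀ e w f → e + - w * f + w * f ≡ e
  cancel = solve-∀

  high : D (e + + w * + (L !))
  high with j , vanishes ← nonneg-shift e (w ℕ.* L !)
         (ℕ.≤-trans (ℕ.m≤n+m ∣ e ∣ (suc B)) (≤shift L w))
    = subst D (trans (ℤ.+-identityˡ (+ j)) (trans (sym vanishes) (cong (λ z → e + z) (ℤ.pos-* w (L !))))) (climb j D0)

  low : D (e + - + w * + (L !))
  low = invariant (extend-independent
    (large⇒independent _ _ (shift-large L B e (+ w) ℕ.≤-refl))
    (large⇒independent _ _ (shift-large L B e (- + w) ℕ.≤-refl))
    (λ d d≢0 d≤L → subst (d ∣_) (lemma e (+ w) (+ (L !))) (∣n⇒∣m*n (+ w + + w) (∣! d d≢0 d≤L)))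
    (≈-refl (1ℤ ∷ []))) high
    where
    lemma : ∀ e w f → (w + w) * f ≡ e + w * f - (e + - w * f)
    lemma = solve-∀

-- A model of LKID on ℤ

private variable
  V W : Set

Form : Set → ℕ → Set
Form = Formula (BaseFun NoFun) (LKIDPred Binary NatPred)

⟦_⟧ᶠ : BaseFun NoFun k → Vec ℤ k → ℤ
⟦ `0 ⟧ᶠ []       = 0ℤ
⟦ `s ⟧ᶠ (x ∷ []) = 1ℤ + x
⟦ fun () ⟧ᶠ

⟦_⟧ᵖ : LKIDPred Binary NatPred k → Vec ℤ k → Set
⟦ ord R ⟧ᵖ (x ∷ y ∷ []) = x + (y + y) + 1ℤ ≢ 0ℤ
⟦ ind N ⟧ᵖ _            = ⊤
⟦ eq ⟧ᵖ    (x ∷ y ∷ []) = x ≡ y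

mutual
  eval : (V → ℤ) → Vec ℤ n → Term (BaseFun NoFun) V n → ℤ
  eval v b (fvar x)  = v x
  eval v b (bvar i)  = lookup b i
  eval v b (fn f ts) = ⟦ f ⟧ᶠ (evals v b ts)

  evals : (V → ℤ) → Vec ℤ n → Vec (Term (BaseFun NoFun) V n) k → Vec ℤ k
  evals v b []       = []
  evals v b (t ∷ ts) = eval v b t ∷ evals v b ts

-- ∨ and ∃ are read through ¬, so that satisfaction is stable and LK is sound.
Sat : (V → ℤ) → Vec ℤ n → Form V n → Set
Sat v b (atom (p ⟨ ts ⟩)) = ⟦ p ⟧ᵖ (evals v b ts)
Sat v b (¬' A)            = ¬ Sat v b A
Sat v b (A ∧' B)          = Sat v b A × Sat v b B
Sat v b (A ∨' B)          = ¬ (¬ Sat v b A × ¬ Sat v b B)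
Sat v b (A ⇒' B)          = Sat v b A → Sat v b B
Sat v b (∀' A)            = ∀ a → Sat v (a ∷ b) A
Sat v b (∃' A)            = ¬ (∀ a → ¬ Sat v (a ∷ b) A)

pred-stable : ∀ (p : LKIDPred Binary NatPred k) xs → ¬ ¬ ⟦ p ⟧ᵖ xs → ⟦ p ⟧ᵖ xs
pred-stable (ord R) (x ∷ y ∷ []) nn e = nn (λ n → n e)
pred-stable (ind N) _            _    = tt
pred-stable eq      (x ∷ y ∷ []) nn   = decidable-stable (x ℤ.≟ y) nn

sat-stable : ∀ {v : V → ℤ} {b : Vec ℤ n} A → ¬ ¬ Sat v b A → Sat v b A
sat-stable (atom (p ⟨ ts ⟩)) nn       = pred-stable p _ nn
sat-stable (¬' A)            nn a     = nn (λ na → na a)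
sat-stable (A ∧' B)          nn       = sat-stable A (λ na → nn (λ p → na (proj₁ p))) , sat-stable B (λ nb → nn (λ p → nb (proj₂ p)))
sat-stable (A ∨' B)          nn q     = nn (λ d → d q)
sat-stable (A ⇒' B)          nn a     = sat-stable B (λ nb → nn (λ f → nb (f a)))
sat-stable (∀' A)            nn a     = sat-stable A (λ na → nn (λ f → na (f a)))
sat-stable (∃' A)            nn none  = nn (λ e → e none)

-- Satisfaction under changes of valuation and substitution

mutual
  eval-agree : ∀ {v w : V → ℤ} {b : Vec ℤ n} t → (∀ x → x ∈ₜ t → v x ≡ w x) → eval v b t ≡ eval w b t
  eval-agree (fvar x)  h = h x here
  eval-agree (bvar i)  h = refl
  eval-agree (fn f ts) h = cong ⟦ f ⟧ᶠ (evals-agree ts (λ x o → h x (arg o)))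

  evals-agree : ∀ {v w : V → ℤ} {b : Vec ℤ n} (ts : Vec _ k) → (∀ x → Vec.Any (x ∈ₜ_) ts → v x ≡ w x) →
                evals v b ts ≡ evals w b ts
  evals-agree []       h = refl
  evals-agree (t ∷ ts) h = cong₂ _∷_ (eval-agree t (λ x o → h x (Vec.here o))) (evals-agree ts (λ x o → h x (Vec.there o)))

sat-agree : ∀ {v w : V → ℤ} {b : Vec ℤ n} A → (∀ x → OccursIn x A → v x ≡ w x) → Sat v b A → Sat w b A
sat-agree (atom (p ⟨ ts ⟩)) h s = subst ⟦ p ⟧ᵖ (evals-agree ts h) s
sat-agree (¬' A)   h s a = s (sat-agree A (λ x o → sym (h x o)) a)
sat-agree (A ∧' B) h (s , t) = sat-agree A (λ x o → h x (inj₁ o)) s , sat-agree B (λ x o → h x (inj₂ o)) t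
sat-agree (A ∨' B) h s (na , nb) =
  s ((λ a → na (sat-agree A (λ x o → h x (inj₁ o)) a)) , (λ b → nb (sat-agree B (λ x o → h x (inj₂ o)) b)))
sat-agree (A ⇒' B) h s a = sat-agree B (λ x o → h x (inj₂ o)) (s (sat-agree A (λ x o → sym (h x (inj₁ o))) a))
sat-agree (∀' A)   h s a = sat-agree A h (s a)
sat-agree (∃' A)   h s none = s (λ a p → none a (sat-agree A h p))

mutual
  eval-bind : ∀ {v : W → ℤ} {w : V → ℤ} {b : Vec ℤ n} {c : Vec ℤ m} {θ β} →
              (∀ x → eval v b (θ x) ≡ w x) → (∀ i → eval v b (β i) ≡ lookup c i) →
              ∀ t → eval v b (bindₜ θ β t) ≡ eval w c t
  eval-bind h g (fvar x)  = h x
  eval-bind h g (bvar i)  = g i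
  eval-bind h g (fn f ts) = cong ⟦ f ⟧ᶠ (evals-bind h g ts)

  evals-bind : ∀ {v : W → ℤ} {w : V → ℤ} {b : Vec ℤ n} {c : Vec ℤ m} {θ β} →
               (∀ x → eval v b (θ x) ≡ w x) → (∀ i → eval v b (β i) ≡ lookup c i) →
               ∀ (ts : Vec _ k) → evals v b (bindₜₛ θ β ts) ≡ evals w c ts
  evals-bind h g []       = refl
  evals-bind h g (t ∷ ts) = cong₂ _∷_ (eval-bind h g t) (evals-bind h g ts)

eval-weaken : ∀ {v : V → ℤ} {b : Vec ℤ n} {a} t → eval v (a ∷ b) (weakenₜ t) ≡ eval v b t
eval-weaken = eval-bind (λ _ → refl) (λ _ → refl)

eval-lift : ∀ {v : W → ℤ} {b : Vec ℤ n} {c : Vec ℤ m} {β : Fin m → Term (BaseFun NoFun) W n} {a} →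
            (∀ i → eval v b (β i) ≡ lookup c i) → ∀ i → eval v (a ∷ b) (liftᵇ β i) ≡ lookup (a ∷ c) i
eval-lift         g zero    = refl
eval-lift {β = β} g (suc i) = trans (eval-weaken (β i)) (g i)

mutual
  -- The two directions are mutual because negation and the left side of an implication exchange
  -- them.
  sat-bind⁻ : ∀ {v : W → ℤ} {w : V → ℤ} {b : Vec ℤ n} {c : Vec ℤ m} {θ β} →
              (∀ x → eval v b (θ x) ≡ w x) → (∀ i → eval v b (β i) ≡ lookup c i) →
              ∀ A → Sat v b (bindᶠ θ β A) → Sat w c A
  sat-bind⁻ h g (atom (p ⟨ ts ⟩)) s = subst ⟦ p ⟧ᵖ (evals-bind h g ts) s
  sat-bind⁻ h g (¬' A)   s a         = s (sat-bind⁺ h g A a)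
  sat-bind⁻ h g (A ∧' B) (s , t)     = sat-bind⁻ h g A s , sat-bind⁻ h g B t
  sat-bind⁻ h g (A ∨' B) s (na , nb) = s ((λ a → na (sat-bind⁻ h g A a)) , (λ b → nb (sat-bind⁻ h g B b)))
  sat-bind⁻ h g (A ⇒' B) s a         = sat-bind⁻ h g B (s (sat-bind⁺ h g A a))
  sat-bind⁻ {θ = θ} h g (∀' A)   s a         = sat-bind⁻ (λ x → trans (eval-weaken (θ x)) (h x)) (eval-lift g) A (s a)
  sat-bind⁻ {θ = θ} h g (∃' A)   s none      =
    s (λ a p → none a (sat-bind⁻ (λ x → trans (eval-weaken (θ x)) (h x)) (eval-lift g) A p))

  sat-bind⁺ : ∀ {v : W → ℤ} {w : V → ℤ} {b : Vec ℤ n} {c : Vec ℤ m} {θ β} →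
              (∀ x → eval v b (θ x) ≡ w x) → (∀ i → eval v b (β i) ≡ lookup c i) →
              ∀ A → Sat w c A → Sat v b (bindᶠ θ β A)
  sat-bind⁺ h g (atom (p ⟨ ts ⟩)) s = subst ⟦ p ⟧ᵖ (sym (evals-bind h g ts)) s
  sat-bind⁺ h g (¬' A)   s a         = s (sat-bind⁻ h g A a)
  sat-bind⁺ h g (A ∧' B) (s , t)     = sat-bind⁺ h g A s , sat-bind⁺ h g B t
  sat-bind⁺ h g (A ∨' B) s (na , nb) = s ((λ a → na (sat-bind⁺ h g A a)) , (λ b → nb (sat-bind⁺ h g B b)))
  sat-bind⁺ h g (A ⇒' B) s a         = sat-bind⁺ h g B (s (sat-bind⁻ h g A a))
  sat-bind⁺ {θ = θ} h g (∀' A)   s a         = sat-bind⁺ (λ x → trans (eval-weaken (θ x)) (h x)) (eval-lift g) A (s a)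
  sat-bind⁺ {θ = θ} h g (∃' A)   s none      =
    s (λ a p → none a (sat-bind⁺ (λ x → trans (eval-weaken (θ x)) (h x)) (eval-lift g) A p))

lookup-evals : ∀ {v : V → ℤ} {b : Vec ℤ n} (ts : Vec _ k) i → eval v b (lookup ts i) ≡ lookup (evals v b ts) i
lookup-evals (t ∷ ts) zero    = refl
lookup-evals (t ∷ ts) (suc i) = lookup-evals ts i

-- Definable sets are invariant

-- The last coefficient is that of the constant term.
constant : ℤ → Vec ℤ (suc n)
constant {zero}  c = c ∷ []
constant {suc n} c = 0ℤ ∷ constant c

coordinate : Fin n → Vec ℤ (suc n)
coordinate zero    = 1ℤ ∷ constant 0ℤ
coordinate (suc i) = 0ℤ ∷ coordinate i

dot-constant : ∀ c (b : Vec ℤ n) → dot (constant c) (b ∷ʳ 1ℤ) ≡ c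
dot-constant c []      = lemma c
  where
  lemma : ∀ c → c * 1ℤ + 0ℤ ≡ c
  lemma = solve-∀
dot-constant c (x ∷ b) = trans (0*x+y x (dot (constant c) (b ∷ʳ 1ℤ))) (dot-constant c b)

dot-coordinate : ∀ i (b : Vec ℤ n) → dot (coordinate i) (b ∷ʳ 1ℤ) ≡ lookup b i
dot-coordinate zero (x ∷ b) = trans (cong (λ z → 1ℤ * x + z) (dot-constant 0ℤ b)) (lemma x)
  where
  lemma : ∀ x → 1ℤ * x + 0ℤ ≡ x
  lemma = solve-∀
dot-coordinate (suc i) (x ∷ b) = trans (0*x+y x (dot (coordinate i) (b ∷ʳ 1ℤ))) (dot-coordinate i b)

-- The appended 1 turns affine functions into linear forms; it stands last so that quantifiers can
-- add elements in front.
Linear : (Vec ℤ n → ℤ) → Set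
Linear {n} f = Σ (Vec ℤ (suc n)) λ cs → ∀ b → dot cs (b ∷ʳ 1ℤ) ≡ f b

linear-combine : ∀ {f g : Vec ℤ n → ℤ} k l → Linear f → Linear g → Linear (λ b → k * f b + l * g b)
linear-combine k l (cs , p) (ds , q) =
  combine k cs l ds , λ b → trans (dot-combine k cs l ds (b ∷ʳ 1ℤ)) (cong₂ (λ x y → k * x + l * y) (p b) (q b))

linear-constant : ∀ c → Linear {n} (λ _ → c)
linear-constant c = constant c , dot-constant c

linear-resp : ∀ {f g : Vec ℤ n → ℤ} → (∀ b → f b ≡ g b) → Linear f → Linear g
linear-resp e (cs , p) = cs , λ b → trans (p b) (e b)

linear-eval : ∀ (v : V → ℤ) (t : Term _ V n) → Linear (λ b → eval v b t)
linear-eval v (fvar x)             = linear-constant (v x)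
linear-eval v (bvar i)             = coordinate i , dot-coordinate i
linear-eval v (fn `0 [])           = linear-constant 0ℤ
linear-eval v (fn `s (t ∷ []))     =
  linear-resp (λ b → lemma (eval v b t)) (linear-combine 1ℤ 1ℤ (linear-constant 1ℤ) (linear-eval v t))
  where
  lemma : ∀ x → 1ℤ * 1ℤ + 1ℤ * x ≡ 1ℤ + x
  lemma = solve-∀
linear-eval v (fn (fun ()) _)

small-norm : (cs : Vec ℤ n) → Small (norm cs) cs
small-norm []       = []
small-norm (c ∷ cs) = ℕ.m≤m+n ∣ c ∣ (norm cs) ∷ small-mono (ℕ.m≤n+m (norm cs) ∣ c ∣) (small-norm cs)

Preserved : ℕ → (Vec ℤ n → Set) → Set
Preserved L D = ∀ {b c} → (b ∷ʳ 1ℤ) ≈[ L ] (c ∷ʳ 1ℤ) → D b → D c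

zero-preserved : ∀ {f : Vec ℤ n → ℤ} → Linear f → ∃ λ L → Preserved L (λ b → f b ≡ 0ℤ)
zero-preserved (cs , p) = norm cs , λ {b} {c} r e →
  trans (sym (p c)) (relationsˡ r cs (small-norm cs) (trans (p b) e))

preserved-¬ : ∀ {D : Vec ℤ n → Set} → Preserved L D → Preserved L (λ b → ¬ D b)
preserved-¬ P r nd d = nd (P (≈-sym r) d)

-- An Ehrenfeucht-Fraïssé argument: atoms need a level bounding their coefficients, connectives the
-- maximum, and each quantifier one use of `refine`. Free variables count as constants, so the level
-- depends on v.
sat-preserved : ∀ (v : V → ℤ) (A : Form V n) → ∃ λ L → Preserved L (λ b → Sat v b A)
sat-preserved v (atom (ord R ⟨ t ∷ u ∷ [] ⟩)) with linear-eval v t | linear-eval v u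
... | lin-t | lin-u with zero-preserved (linear-resp {g = λ b → eval v b t + (eval v b u + eval v b u) + 1ℤ}
                     (λ b → lemma (eval v b t) (eval v b u))
                     (linear-combine 1ℤ 1ℤ (linear-combine 1ℤ (+ 2) lin-t lin-u) (linear-constant 1ℤ)))
  where
  lemma : ∀ x y → 1ℤ * (1ℤ * x + + 2 * y) + 1ℤ * 1ℤ ≡ x + (y + y) + 1ℤ
  lemma = solve-∀
... | L , P = L , preserved-¬ P
sat-preserved v (atom (ind N ⟨ _ ⟩)) = 0 , λ _ _ → tt
sat-preserved v (atom (eq ⟨ t ∷ u ∷ [] ⟩)) with zero-preserved (linear-combine 1ℤ -1ℤ (linear-eval v t) (linear-eval v u))
... | L , P = L , λ {b} {c} r e → back (eval v c t) (eval v c u) (P r (forth (eval v b t) (eval v b u) e))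
  where
  forth : ∀ x y → x ≡ y → 1ℤ * x + -1ℤ * y ≡ 0ℤ
  forth x .x refl = lemma x
    where
    lemma : ∀ x → 1ℤ * x + -1ℤ * x ≡ 0ℤ
    lemma = solve-∀
  back : ∀ x y → 1ℤ * x + -1ℤ * y ≡ 0ℤ → x ≡ y
  back x y e = ℤ.i-j≡0⇒i≡j x y (trans (lemma x y) e)
    where
    lemma : ∀ x y → x - y ≡ 1ℤ * x + -1ℤ * y
    lemma = solve-∀
sat-preserved v (¬' A) with sat-preserved v A
... | L , P = L , preserved-¬ P
sat-preserved v (A ∧' B) with sat-preserved v A | sat-preserved v B
... | L , P | M , Q = L ⊔ M , λ r (a , b) → P (≈-mono (ℕ.m≤m⊔n L M) r) a , Q (≈-mono (ℕ.m≤n⊔m L M) r) b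
sat-preserved v (A ∨' B) with sat-preserved v A | sat-preserved v B
... | L , P | M , Q = L ⊔ M , λ r d (na , nb) →
  d ((λ a → na (P (≈-mono (ℕ.m≤m⊔n L M) r) a)) , (λ b → nb (Q (≈-mono (ℕ.m≤n⊔m L M) r) b)))
sat-preserved v (A ⇒' B) with sat-preserved v A | sat-preserved v B
... | L , P | M , Q = L ⊔ M , λ r f a → Q (≈-mono (ℕ.m≤n⊔m L M) r) (f (P (≈-mono (ℕ.m≤m⊔n L M) (≈-sym r)) a))
sat-preserved v (∀' A) with sat-preserved v A
... | L , P = refine L , λ {b} {c} r f a → sat-stable A λ na →
  -- The challenge a lies on the side of c, so the answer is sought on the side of b, where the
  -- universal formula is known.
  back-and-forth (c ∷ʳ 1ℤ) (b ∷ʳ 1ℤ) (≈-sym r) a λ (a′ , r′) → na (P (≈-sym r′) (f a′))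
sat-preserved v (∃' A) with sat-preserved v A
... | L , P = refine L , λ {b} {c} r e none → e λ a s →
  back-and-forth (b ∷ʳ 1ℤ) (c ∷ʳ 1ℤ) r a λ (a′ , r′) → none a′ (P r′ s)

sat-induction : ∀ (v : V → ℤ) (A : Form V 1) → Sat v (0ℤ ∷ []) A →
                (∀ a → Sat v (a ∷ []) A → Sat v (1ℤ + a ∷ []) A) → ∀ a → Sat v (a ∷ []) A
sat-induction v A = ℤ-induction (proj₂ (sat-preserved v A))

-- Soundness of LKID

open LKID {BaseFun NoFun} {Binary} {NatPred} Φ-N

update : (ℕ → ℤ) → ℕ → ℤ → ℕ → ℤ
update v x a z = if does (z ℕ.≟ x) then a else v z

update-same : ∀ v x a → update v x a x ≡ a
update-same v x a = cong (λ d → if d then a else v x) (dec-true (x ℕ.≟ x) refl)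

update-other : ∀ v x a z → z ≢ x → update v x a z ≡ v z
update-other v x a z z≢x = cong (λ d → if d then a else v z) (dec-false (z ℕ.≟ x) z≢x)

Valid : List (Fm 0) → List (Fm 0) → Set
Valid Γ Δ = ∀ v → ListAll.All (Sat v []) Γ → ¬ ListAll.All (λ A → ¬ Sat v [] A) Δ

private variable
  v w : ℕ → ℤ
  x : ℕ
  Γ Δ : List (Fm 0)

sat-update : ∀ {b : Vec ℤ n} (A : Fm n) → ¬ OccursIn x A → Sat v b A → Sat (update v x a) b A
sat-update {x = x} {v = v} A x∉A =
  sat-agree A (λ z o → sym (update-other v x _ z (λ { refl → x∉A o })))

sat-update⁻ : ∀ {b : Vec ℤ n} (A : Fm n) → ¬ OccursIn x A → Sat (update v x a) b A → Sat v b A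
sat-update⁻ {x = x} {v = v} A x∉A =
  sat-agree A (λ z o → update-other v x _ z (λ { refl → x∉A o }))

update-all : FreshFor x Γ → ListAll.All (Sat v []) Γ → ListAll.All (Sat (update v x a) []) Γ
update-all []       []       = []
update-all {Γ = A ∷ _} (p ∷ ps) (s ∷ ss) = sat-update A p s ∷ update-all ps ss

update-none : FreshFor x Δ → ListAll.All (λ A → ¬ Sat v [] A) Δ → ListAll.All (λ A → ¬ Sat (update v x a) [] A) Δ
update-none []       []       = []
update-none {Δ = A ∷ _} (p ∷ ps) (s ∷ ss) = (λ t → s (sat-update⁻ A p t)) ∷ update-none ps ss

sat-instance⁻ : ∀ (A : Fm 1) t → Sat v [] (A [ t ]) → Sat v (eval v [] t ∷ []) A
sat-instance⁻ A t = sat-bind⁻ (λ _ → refl) (λ { zero → refl }) A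

sat-instance⁺ : ∀ (A : Fm 1) t → Sat v (eval v [] t ∷ []) A → Sat v [] (A [ t ])
sat-instance⁺ A t = sat-bind⁺ (λ _ → refl) (λ { zero → refl }) A

sat-eigen⁻ : ∀ (A : Fm 1) → ¬ OccursIn x A → Sat (update v x a) [] (A [ fvar x ]) → Sat v (a ∷ []) A
sat-eigen⁻ {x = x} {v = v} {a = a} A x∉A s =
  sat-update⁻ A x∉A (subst (λ z → Sat (update v x a) (z ∷ []) A) (update-same v x a) (sat-instance⁻ A (fvar x) s))

sat-eigen⁺ : ∀ (A : Fm 1) → ¬ OccursIn x A → Sat v (a ∷ []) A → Sat (update v x a) [] (A [ fvar x ])
sat-eigen⁺ {x = x} {v = v} {a = a} A x∉A s =
  sat-instance⁺ A (fvar x) (subst (λ z → Sat (update v x a) (z ∷ []) A) (sym (update-same v x a)) (sat-update A x∉A s))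

sat-subst⁻ : ∀ {θ} A → (∀ z → eval v [] (θ z) ≡ w z) → Sat v [] (substᶠ θ A) → Sat w [] A
sat-subst⁻ A h = sat-bind⁻ h (λ ()) A

sat-subst⁺ : ∀ {θ} A → (∀ z → eval v [] (θ z) ≡ w z) → Sat w [] A → Sat v [] (substᶠ θ A)
sat-subst⁺ A h = sat-bind⁺ h (λ ()) A

sat-N : ∀ (a : Atom (BaseFun NoFun) NatPred ℕ 0) → Sat v [] ⌜ a ⌝ⁱ
sat-N (N ⟨ _ ⟩) = tt

sat-generalise⁻ : ∀ (G : InductionFormulas) t → Sat v [] (generalise G (N ⟨ t ∷ [] ⟩)) → Sat v (eval v [] t ∷ []) (G N)
sat-generalise⁻ G t = sat-bind⁻ (λ _ → refl) (λ { zero → refl }) (G N)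

sat-generalise⁺ : ∀ (G : InductionFormulas) t → Sat v (eval v [] t ∷ []) (G N) → Sat v [] (generalise G (N ⟨ t ∷ [] ⟩))
sat-generalise⁺ G t = sat-bind⁺ (λ _ → refl) (λ { zero → refl }) (G N)

swap-eval : ∀ x y t u → eval v [] t ≡ eval v [] u → ∀ z →
  eval v [] (if does (z ℕ.≟ x) then u else if does (z ℕ.≟ y) then t else fvar z) ≡
  eval v [] (if does (z ℕ.≟ x) then t else if does (z ℕ.≟ y) then u else fvar z)
swap-eval x y t u e z with does (z ℕ.≟ x) | does (z ℕ.≟ y)
... | true  | _     = sym e
... | false | true  = e
... | false | false = refl

-- Leaving a premise unchanged requires that it be independent of the predicate inducted on. As N
-- depends on itself by the empty path, the hypotheses of the minor premises are forced.
hypotheses-generalised : ∀ {P as Hs} (G : InductionFormulas) → ListAll.All (λ a → MutuallyDependent P (head a)) as →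
                         Pointwiseᴸ (Hypothesis G P) as Hs → Hs ≡ map (generalise G) as
hypotheses-generalised G []           []                   = refl
hypotheses-generalised G (_ ∷ deps)   (generalised _ ∷ hs) = cong (_ ∷_) (hypotheses-generalised G deps hs)
hypotheses-generalised G (dep ∷ deps) (unchanged ¬dep ∷ _) = contradiction dep ¬dep

-- Right introduction for N is immediate because N holds everywhere. The induction rule is where
-- indiscernibility enters, through `sat-induction`.
sound : Γ ⊢ Δ → Valid Γ Δ
sound (ax A∈Γ A∈Δ) v γ δ = ListAll.lookup δ A∈Δ (ListAll.lookup γ A∈Γ)
sound (wk Γ′⊆Γ Δ′⊆Δ π) v γ δ = sound π v (anti-mono Γ′⊆Γ γ) (anti-mono Δ′⊆Δ δ)
sound (cut A π π′) v γ δ = sound π v γ ((λ a → sound π′ v (a ∷ γ) δ) ∷ δ)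
sound (sub θ π) v γ δ = sound π (λ z → eval v [] (θ z))
  (ListAll.map (λ {A} → sat-subst⁻ A (λ _ → refl)) (map⁻ γ))
  (ListAll.map (λ {A} na a → na (sat-subst⁺ A (λ _ → refl) a)) (map⁻ δ))
sound (¬l π) v (na ∷ γ) δ = sound π v γ (na ∷ δ)
sound (¬r π) v γ (nna ∷ δ) = nna (λ a → sound π v (a ∷ γ) δ)
sound (∧l π) v ((a , b) ∷ γ) δ = sound π v (a ∷ b ∷ γ) δ
sound (∧r π π′) v γ (nab ∷ δ) = sound π v γ ((λ a → sound π′ v γ ((λ b → nab (a , b)) ∷ δ)) ∷ δ)
sound (∨l π π′) v (ab ∷ γ) δ = ab ((λ a → sound π v (a ∷ γ) δ) , (λ b → sound π′ v (b ∷ γ) δ))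
sound (∨r π) v γ (nab ∷ δ) = nab (λ (na , nb) → sound π v γ (na ∷ nb ∷ δ))
sound (⇒l π π′) v (f ∷ γ) δ = sound π v γ ((λ a → sound π′ v (f a ∷ γ) δ) ∷ δ)
sound (⇒r {B = B} π) v γ (nf ∷ δ) = nf (λ a → sat-stable B (λ nb → sound π v (a ∷ γ) (nb ∷ δ)))
sound (∀l {A = A} t π) v (f ∷ γ) δ = sound π v (sat-instance⁺ A t (f (eval v [] t)) ∷ γ) δ
sound (∀r {Γ = Γ} {A = A} x (x∉A ∷ fresh) π) v γ (nf ∷ δ) = nf λ a → sat-stable A λ na →
  sound π (update v x a) (update-all (++⁻ˡ Γ fresh) γ)
    ((λ s → na (sat-eigen⁻ A x∉A s)) ∷ update-none (++⁻ʳ Γ fresh) δ)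
sound (∃l {Γ = Γ} {A = A} x (x∉A ∷ fresh) π) v (e ∷ γ) δ = e λ a s →
  sound π (update v x a) (sat-eigen⁺ A x∉A s ∷ update-all (++⁻ˡ Γ fresh) γ)
    (update-none (++⁻ʳ Γ fresh) δ)
sound (∃r {A = A} t π) v γ (ne ∷ δ) =
  ne λ none → sound π v γ ((λ s → none (eval v [] t) (sat-instance⁻ A t s)) ∷ δ)
sound (=l x y t u π) v (e ∷ γ) δ = sound π v
  (map⁺ (ListAll.map (λ {A} s → sat-subst⁺ A (swap-eval x y t u e) (sat-subst⁻ A (λ _ → refl) s)) (map⁻ γ)))
  (map⁺ (ListAll.map (λ {A} na s → na (sat-subst⁺ A (λ _ → refl) (sat-subst⁻ A (swap-eval x y t u e) s))) (map⁻ δ)))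
sound (=r t) v γ (ne ∷ δ) = ne refl
sound (indR {pr = pr} _ θ _ _) v γ (nN ∷ δ) = nN (sat-N (substₐ θ (Production.conclusion pr)))
sound (indL {Γ = Γ} {p = N} {ts = t ∷ []} G y H side minor π) v (_ ∷ γ) δ =
  sound π v (sat-generalise⁺ G t (sat-induction v (G N) zero-case suc-case (eval v [] t)) ∷ γ) δ
  where
  zero-case : Sat v (0ℤ ∷ []) (G N)
  zero-case = sat-stable (G N) λ no →
    subst (λ Hs → Valid (Hs ++ Γ) _)
      (hypotheses-generalised G [] (proj₂ (proj₂ (side (here refl) (ε , ε)))))
      (sound (minor (here refl) (ε , ε)))
      v γ ((λ s → no (sat-generalise⁻ G _ s)) ∷ δ)

  suc-case : ∀ a → Sat v (a ∷ []) (G N) → Sat v (1ℤ + a ∷ []) (G N)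
  suc-case a s with side (there (here refl)) (ε , ε) | minor (there (here refl)) (ε , ε)
  ... | _ , fresh , hyps | π₁ with fresh zero
  ...   | (_ ∷ fresh′) , fresh-G = sat-stable (G N) λ no →
    -- The eigenvariable takes the value a; by freshness this affects neither the context nor the
    -- induction formula.
    subst (λ Hs → Valid (Hs ++ Γ) _) (hypotheses-generalised G ((ε , ε) ∷ []) hyps) (sound π₁) (update v z a)
      (sat-generalise⁺ G (fvar z) (subst (λ i → Sat (update v z a) (i ∷ []) (G N)) (sym (update-same v z a)) (sat-update (G N) z∉G s))
        ∷ update-all (++⁻ˡ Γ fresh′) γ)
      ((λ s′ → no (sat-update⁻ (G N) z∉G
          (subst (λ i → Sat (update v z a) (1ℤ + i ∷ []) (G N)) (update-same v z a) (sat-generalise⁻ G _ s′))))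
        ∷ update-none (++⁻ʳ Γ fresh′) δ)
    where
    z = y _ zero
    z∉G = fresh-G N (ε , ε)

-- Failure of the statement in the model

odd≢0 : ∀ y → 0ℤ + (y + y) + 1ℤ ≢ 0ℤ
odd≢0 (+ n) e = ℕ.1+n≢0 (trans (ℕ.+-comm 1 (n ℕ.+ n)) (ℤ.+-injective e))
odd≢0 -[1+ n ] ()

halving-unprovable : ¬ ProvableInLKID halving
-- The two `tt` are the restrictions of the parameters to N. The succedent fails at (1, -1) because
-- 1 - 2 + 1 = 0.
halving-unprovable π = sound π ν (tt ∷ tt ∷ odd≢0 ∷ jump ∷ transfer ∷ []) ((λ holds → holds refl) ∷ [])
  where
  ν : ℕ → ℤ
  ν zero    = 1ℤ
  ν (suc _) = -1ℤ

  -- The form in the conclusion is twice the form in the premise.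
  jump : ∀ y → y + (0ℤ + 0ℤ) + 1ℤ ≢ 0ℤ → (1ℤ + 0ℤ) + (y + y) + 1ℤ ≢ 0ℤ
  jump y holds e with ℤ.i*j≡0⇒i≡0∨j≡0 (+ 2) (trans (lemma y) e)
    where
    lemma : ∀ y → + 2 * (y + (0ℤ + 0ℤ) + 1ℤ) ≡ (1ℤ + 0ℤ) + (y + y) + 1ℤ
    lemma = solve-∀
  ... | inj₂ fails = holds fails

  -- Both forms equal x + 2y + 3.
  transfer : ∀ x y → x + ((1ℤ + y) + (1ℤ + y)) + 1ℤ ≢ 0ℤ → (1ℤ + (1ℤ + x)) + (y + y) + 1ℤ ≢ 0ℤ
  transfer x y holds e = holds (trans (lemma x y) e)
    where
    lemma : ∀ x y → x + ((1ℤ + y) + (1ℤ + y)) + 1ℤ ≡ (1ℤ + (1ℤ + x)) + (y + y) + 1ℤ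
    lemma = solve-∀

corollary6p1 : Σ Symbols λ F → Σ Symbols λ P → Σ (InductiveStatement F P) λ S → ProvableByProofSchema S × ¬ ProvableInLKID S
corollary6p1 = NoFun , Binary , halving , halving-provable , halving-unprovable
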